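{- Let $T$ be a tournament on $n\ge 9$ vertices with $\pi_2(T)>(n-9)/12$. If $i(T)< 2\pi_2(T)-(n+8)/6$, then $T$ is path extendable.
   Context: For distinct vertices $u,v$ of a tournament $T$, $p_2(u,v)$ denotes the number of directed paths of length $2$ (i.e. with $2$ arcs) from $u$ to $v$ in $T$, and $\pi_2(T)=\min\{p_2(u,v) : u,v\in V(T),\ u\neq v\}$. The irregularity of $T$ is $i(T)=\max\{|d^+(u)-d^-(u)| : u\in V(T)\}$. All paths are directed paths. A path $P$ that is not hamiltonian is called extendable if there is a path $P'$ with the same initial and the same terminal vertex as $P$ and $V(P')=V(P)\cup\{w\}$ for some vertex $w\in V(T)\setminus V(P)$. A digraph is path extendable if every nonhamiltonian path of length at least $1$ in it is extendable. -}

module Defs where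

open import Data.Nat using (ℕ; zero; suc; _+_; _*_; _<_; _≤_; _⊓_; _⊔_; ∣_-_∣)
open import Data.Bool using (Bool; true; false; not; _∧_; if_then_else_)
open import Data.Fin using (Fin; _≟_)
open import Data.List using (List; []; _∷_; allFin; foldr; map; concatMap; filter; length; head; last)
open import Data.List.Membership.Propositional using (_∈_; _∉_)
open import Data.List.Relation.Unary.Unique.Propositional using (Unique)
open import Data.Maybe using (Maybe)
open import Data.Product using (Σ; _×_; ∃)
open import Data.Sum using (_⊎_)
open import Data.Unit using (⊤)
open import Relation.Nullary using (¬_; does)
open import Relation.Binary.PropositionalEquality using (_≡_; _≢_)
open import Function.Bundles using (_⇔_)

record Tournament (n : ℕ) : Set where
  field
    arc       : Fin n → Fin n → Bool
    irrefl    : ∀ u → arc u u ≡ false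
    tourn     : ∀ u v → u ≢ v → arc u v ≡ not (arc v u)
open Tournament public

countB : ∀ {A : Set} → (A → Bool) → List A → ℕ
countB p []       = zero
countB p (x ∷ xs) = (if p x then 1 else 0) + countB p xs

module _ {n : ℕ} (T : Tournament n) where

  outdeg : Fin n → ℕ
  outdeg u = countB (λ w → arc T u w) (allFin n)

  indeg : Fin n → ℕ
  indeg u = countB (λ w → arc T w u) (allFin n)

  p₂ : Fin n → Fin n → ℕ
  p₂ u v = countB (λ w → arc T u w ∧ arc T w v) (allFin n)

  distinctPairs : List (Fin n × Fin n)
  distinctPairs = concatMap (λ u → map (λ v → u Data.Product., v)
                    (filter (λ v → ¬? (u ≟ v)) (allFin n))) (allFin n)
    where open import Relation.Nullary.Decidable using (¬?)

  -- minimum of a nonempty list (0 on the empty list; irrelevant for n ≥ 2)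
  private
    minList : List ℕ → ℕ
    minList []       = 0
    minList (x ∷ xs) = foldr _⊓_ x xs

  π₂ : ℕ
  π₂ = minList (map (λ uv → p₂ (Data.Product.proj₁ uv) (Data.Product.proj₂ uv)) distinctPairs)

  irregularity : ℕ
  irregularity = foldr _⊔_ 0 (map (λ u → ∣ outdeg u - indeg u ∣) (allFin n))

  Arcs : List (Fin n) → Set
  Arcs []           = ⊤
  Arcs (x ∷ [])     = ⊤
  Arcs (x ∷ y ∷ xs) = (arc T x y ≡ true) × Arcs (y ∷ xs)

  IsPath : List (Fin n) → Set
  IsPath P = Unique P × Arcs P

  Extendable : List (Fin n) → Set
  Extendable P = Σ (Fin n) λ w → w ∉ P × Σ (List (Fin n)) λ P' →
    IsPath P' × head P' ≡ head P × last P' ≡ last P ×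
    (∀ x → (x ∈ P') ⇔ (x ≡ w ⊎ x ∈ P))

  -- every nonhamiltonian path of length ≥ 1 (i.e. ≥ 2 vertices) is extendable
  PathExtendable : Set
  PathExtendable = ∀ P → IsPath P → 2 ≤ length P → length P < n → Extendable P

{-# OPTIONS --safe #-}
module Submission where

-- Let P = x₁ … x_p be a path that cannot be extended, π = π₂(T), i = i(T), and let R be the set of
-- vertices outside P.  No z ∈ R can be inserted between consecutive vertices, so z dominates an
-- initial segment of P and is dominated by the rest; hence all 2-paths from x_a to x_b with a < b
-- stay inside P.  Averaging in-degrees over an out-neighbourhood that contains all the relevant
-- 2-paths shows that it has at least 2π + 1 elements, and this forces p ≥ 4π + 1.
--
-- If every z ∈ R is dominated by all of P − x₁ or dominates all of P − x_p, then a vertex of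
-- in-degree at least average in the first class and a vertex of out-degree at least average in the
-- second class give 3p ≤ n + 2i + 4, which is absurd.
-- Otherwise some z has x_{p-1} → z → x₂, and x₁ x_k … x_{p-1} z x₂ … x_{k-1} x_p shows that
-- x₁ → x_k and x_{k-1} → x_p never hold together; so d⁺(x_p) + 2 exceeds d⁺(x₁) by at least
-- the number of z ∈ R with x_p → z → x₁, and that number is at most i + 2.  The same degree count
-- now gives 3p ≤ n + 3i + 2, unless R has no vertex dominated by all of P or none dominating all
-- of P; in these cases the neighbourhoods inside R turn out to be too large.

open import Defs
open import Data.Bool as Bool using (Bool; true; false; not; _∧_; if_then_else_)
open import Data.Empty using (⊥; ⊥-elim)
open import Data.Fin using (Fin; zero; suc)
open import Data.Fin.Properties using (any?; all?) renaming (_≟_ to _≟ᶠ_)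
open import Data.List using (List; []; _∷_; _++_; [_]; length; map; filter; head; last; foldr;
  allFin; tabulate)
open import Data.List.Membership.Propositional using (_∈_; _∉_; lose)
open import Data.List.Membership.Propositional.Properties
  using (∈-++⁺ˡ; ∈-++⁺ʳ; ∈-++⁻; ∈-map⁺; ∈-allFin; ∈-concatMap⁺; ∈-filter⁺)
open import Data.List.Properties using (++-assoc; filter-all)
open import Data.List.Relation.Binary.Permutation.Propositional
  using (_↭_; ↭-sym; ↭⇒↭ₛ; module PermutationReasoning)
open import Data.List.Relation.Binary.Permutation.Propositional.Properties
  using (∈-resp-↭; shift; ++-comm; ++⁺ˡ; ++⁺ʳ)
open import Data.List.Relation.Unary.Any using (here; there)
open import Data.List.Relation.Unary.Unique.DecPropositional using (unique?)
open import Data.List.Relation.Unary.Unique.Propositional using (Unique)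
open import Data.Maybe using (just)
open import Data.Nat using (ℕ; zero; suc; _+_; _*_; _<_; _≤_; _<?_; _≤?_; z≤n; s≤s; _⊓_; _⊔_; ∣_-_∣)
open import Data.Nat.Properties hiding (_≟_)
open import Data.Nat.Tactic.RingSolver using (solve-∀; solve)
open import Data.Product using (∃; _×_; _,_; proj₁; proj₂; swap)
open import Data.Sum using (_⊎_; inj₁; inj₂; [_,_]′)
open import Data.Unit using (tt)
open import Function using (_∘_; id; flip; mk⇔)
open import Function.Bundles using (Equivalence)
open import Level using (0ℓ)
open import Relation.Binary.PropositionalEquality hiding ([_])
open import Relation.Nullary using (¬_; Dec; yes; no; does; contradiction)
open import Relation.Nullary.Decidable
  using (decidable-stable; map′; _×-dec_; _⊎-dec_; _→-dec_; ¬?)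
open import Relation.Unary using (Pred; Decidable; _∪_; _⊆_)
open import Relation.Unary.Properties using (_∩?_; ∁?; U?)
open import Algebra.Properties.Semiring.Sum +-*-semiring
  using (sum; sum-cong-≗; *-distribˡ-sum; ∑-comm; ∑-distrib-+)
import Data.List.Membership.DecPropositional as DecMembership
import Data.List.Relation.Binary.Permutation.Setoid.Properties as Permutationₛ
import Data.Maybe.Properties as Maybe

-- Linear arithmetic over the natural numbers

exceeds⇒⊥ : ∀ k {l r} → l ≤ r → l ≡ suc (k + r) → ⊥
exceeds⇒⊥ k l≤r eq = <⇒≱ (s≤s (m≤n+m _ k)) (subst (_≤ _) eq l≤r)

infixl 6 _⊕_
infixl 7 _⊛_

_⊕_ : ∀ {a b c d} → a ≤ b → c ≤ d → a + c ≤ b + d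
_⊕_ = +-mono-≤

_⊛_ : ∀ k {a b} → a ≤ b → k * a ≤ k * b
k ⊛ a≤b = *-monoʳ-≤ k a≤b

-- (1 + m) (a − b) ≤ m − k + (l − r) ≤ m forces a ≤ b.
by-combination : ∀ m k {a b l r} → l ≤ r → suc m * b + m + l ≡ k + (suc m * a + r) → a ≤ b
by-combination m k {a} {b} {l} {r} l≤r eq = ≮⇒≥ λ b<a → 1+n≰n (begin
  suc (suc m * b + m + l)    ≡⟨ cong (_+ l) (+-suc (suc m * b) m) ⟨
  suc m * b + suc m + l      ≡⟨ cong (_+ l) (+-comm (suc m * b) (suc m)) ⟩
  suc m + suc m * b + l      ≡⟨ cong (_+ l) (*-suc (suc m) b) ⟨
  suc m * suc b + l          ≤⟨ suc m ⊛ b<a ⊕ l≤r ⟩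
  suc m * a + r              ≤⟨ m≤n+m _ k ⟩
  k + (suc m * a + r)        ≡⟨ eq ⟨
  suc m * b + m + l ∎)
  where open ≤-Reasoning

-- Used with `a` and `c` the two semidegrees of a vertex, which differ by at most i.
2a+1≤ : ∀ a c {n i} → a ≤ c + i → a + c + 1 ≤ n → 2 * a + 1 ≤ n + i
2a+1≤ a c {n} {i} h₁ h₂ = by-combination 0 0 (h₁ ⊕ h₂) (solve (a ∷ c ∷ n ∷ i ∷ []))

-- Counting the vertices that satisfy a decidable predicate

⟦_⟧ : Bool → ℕ
⟦ b ⟧ = if b then 1 else 0

sum-mono-≤ : ∀ {n} {f g : Fin n → ℕ} → (∀ v → f v ≤ g v) → sum f ≤ sum g
sum-mono-≤ {zero}  f≤g = z≤n
sum-mono-≤ {suc n} f≤g = +-mono-≤ (f≤g zero) (sum-mono-≤ (f≤g ∘ suc))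

private variable n : ℕ

infix 8 #_

opaque
  #_ : {P : Pred (Fin n) 0ℓ} → Decidable P → ℕ
  # P? = sum (λ v → ⟦ does (P? v) ⟧)

module _ {n} {P Q : Pred (Fin n) 0ℓ} (P? : Decidable P) (Q? : Decidable Q) where

  opaque
    unfolding #_

    #-mono : P ⊆ Q → # P? ≤ # Q?
    #-mono P⊆Q = sum-mono-≤ {n} pointwise
      where
      pointwise : ∀ v → ⟦ does (P? v) ⟧ ≤ ⟦ does (Q? v) ⟧
      pointwise v with P? v | Q? v
      ... | no  _  | _      = z≤n
      ... | yes _  | yes _  = s≤s z≤n
      ... | yes pv | no ¬qv = contradiction (P⊆Q pv) ¬qv

  module _ {R : Pred (Fin n) 0ℓ} (R? : Decidable R) where

    opaque
      unfolding #_

      #-∪ : P ⊆ Q ∪ R → # P? ≤ # Q? + # R?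
      #-∪ P⊆Q∪R = ≤-trans (sum-mono-≤ {n} pointwise) (≤-reflexive (∑-distrib-+ {n} _ _))
        where
        pointwise : ∀ v → ⟦ does (P? v) ⟧ ≤ ⟦ does (Q? v) ⟧ + ⟦ does (R? v) ⟧
        pointwise v with P? v | Q? v | R? v
        ... | no  _  | _      | _      = z≤n
        ... | yes _  | yes _  | _      = s≤s z≤n
        ... | yes _  | no  _  | yes _  = s≤s z≤n
        ... | yes pv | no ¬qv | no ¬rv = ⊥-elim ([ ¬qv , ¬rv ]′ (P⊆Q∪R pv))

      #-disjoint : P ⊆ R → Q ⊆ R → (∀ {v} → P v → ¬ Q v) → # P? + # Q? ≤ # R?
      #-disjoint P⊆R Q⊆R P∦Q =
        ≤-trans (≤-reflexive (sym (∑-distrib-+ {n} _ _))) (sum-mono-≤ {n} pointwise)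
        where
        pointwise : ∀ v → ⟦ does (P? v) ⟧ + ⟦ does (Q? v) ⟧ ≤ ⟦ does (R? v) ⟧
        pointwise v with P? v | Q? v | R? v
        ... | no  _  | no  _  | _      = z≤n
        ... | yes pv | yes qv | _      = contradiction qv (P∦Q pv)
        ... | yes _  | no  _  | yes _  = s≤s z≤n
        ... | no  _  | yes _  | yes _  = s≤s z≤n
        ... | yes pv | no  _  | no ¬rv = contradiction (P⊆R pv) ¬rv
        ... | no  _  | yes qv | no ¬rv = contradiction (Q⊆R qv) ¬rv

opaque
  unfolding #_

  #-empty : {P : Pred (Fin n) 0ℓ} (P? : Decidable P) → (∀ v → ¬ P v) → # P? ≡ 0
  #-empty {zero}  P? ¬P = refl
  #-empty {suc n} P? ¬P with P? zero
  ... | yes p = contradiction p (¬P zero)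
  ... | no  _ = #-empty (P? ∘ suc) (¬P ∘ suc)

  #-U : # (U? {A = Fin n}) ≡ n
  #-U {zero}  = refl
  #-U {suc n} = cong suc #-U

  #-≡ : (g : Fin n) → # (_≟ᶠ g) ≡ 1
  #-≡ {suc n} zero    = cong suc (#-empty {n} (λ v → suc v ≟ᶠ zero) (λ _ ()))
  #-≡ {suc n} (suc g) = trans
    (≤-antisym (#-mono (λ v → suc v ≟ᶠ suc g) (_≟ᶠ g) λ { refl → refl })
               (#-mono (_≟ᶠ g) (λ v → suc v ≟ᶠ suc g) λ { refl → refl }))
    (#-≡ g)

module _ {n} {P : Pred (Fin n) 0ℓ} (P? : Decidable P) where

  #-inhabited : 1 ≤ # P? → ∃ P
  #-inhabited 1≤#P with any? P?
  ... | yes p = p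
  ... | no ¬p = contradiction (subst (1 ≤_) (#-empty P? (λ v pv → ¬p (v , pv))) 1≤#P) λ ()

  #-subsingleton : (g : Fin n) → (∀ v → P v → v ≡ g) → # P? ≤ 1
  #-subsingleton g P⊆g = ≤-trans (#-mono P? (_≟ᶠ g) (P⊆g _)) (≤-reflexive (#-≡ g))

  #-∃ : ∃ P → 1 ≤ # P?
  #-∃ (g , pg) = ≤-trans (≤-reflexive (sym (#-≡ g))) (#-mono (_≟ᶠ g) P? λ { refl → pg })

  #-delete : (g : Fin n) → # P? ≤ 1 + # (P? ∩? ∁? (_≟ᶠ g))
  #-delete g = subst (λ k → # P? ≤ k + # (P? ∩? ∁? (_≟ᶠ g))) (#-≡ g)
    (#-∪ P? (_≟ᶠ g) (P? ∩? ∁? (_≟ᶠ g)) split)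
    where
    split : ∀ {v} → P v → v ≡ g ⊎ (P v × v ≢ g)
    split {v} pv with v ≟ᶠ g
    ... | yes v≡g = inj₁ v≡g
    ... | no  v≢g = inj₂ (pv , v≢g)

#-⊊ : {P Q : Pred (Fin n) 0ℓ} (P? : Decidable P) (Q? : Decidable Q) →
      P ⊆ Q → ∀ {g} → Q g → ¬ P g → # P? < # Q?
#-⊊ P? Q? P⊆Q {g} qg ¬pg = ≤-trans
  (≤-reflexive (trans (+-comm 1 _) (cong (# P? +_) (sym (#-≡ g)))))
  (#-disjoint P? (_≟ᶠ g) Q? P⊆Q (λ { refl → qg }) (λ { pv refl → ¬pg pv }))

minimiser : {P : Pred (Fin n) 0ℓ} (P? : Decidable P) (f : Fin n → ℕ) → ∃ P →
            ∃ λ v → P v × (∀ w → P w → f v ≤ f w)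
minimiser {P = P} P? f (v , pv) = descend (f v) v pv ≤-refl
  where
  descend : ∀ k v → P v → f v ≤ k → ∃ λ v → P v × (∀ w → P w → f v ≤ f w)
  descend k v pv fv≤k with any? (λ w → P? w ×-dec f w <? f v)
  ... | no  ¬w             = v , pv , λ w pw → ≮⇒≥ (λ fw<fv → ¬w (w , pw , fw<fv))
  descend zero    v pv fv≤0  | yes (w , _  , fw<fv) = contradiction (≤-trans fw<fv fv≤0) λ ()
  descend (suc k) v pv fv≤1+k | yes (w , pw , fw<fv) =
    descend k w pw (≤-pred (≤-trans fw<fv fv≤1+k))

-- Degrees inside a set of vertices, and averaging

module Arrows {n} (T : Tournament n) where

  infix 4 _⟶_ _⟶?_

  _⟶_ : Fin n → Fin n → Set
  u ⟶ v = arc T u v ≡ true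

  _⟶?_ : ∀ u v → Dec (u ⟶ v)
  u ⟶? v = arc T u v Bool.≟ true

  out? : ∀ u → Decidable (u ⟶_)
  out? u v = u ⟶? v

  in? : ∀ v → Decidable (_⟶ v)
  in? v u = u ⟶? v

  ⟶⇒≢ : ∀ {u v} → u ⟶ v → u ≢ v
  ⟶⇒≢ {u} u⟶u refl with () ← trans (sym u⟶u) (irrefl T u)

  ⟶-asym : ∀ {u v} → u ⟶ v → ¬ v ⟶ u
  ⟶-asym {u} {v} uv vu
    with () ← trans (sym uv) (trans (tourn T u v (⟶⇒≢ uv)) (cong not vu))

  ⟶-total : ∀ {u v} → u ≢ v → ¬ u ⟶ v → v ⟶ u
  ⟶-total {u} {v} u≢v ¬uv with arc T v u | tourn T u v u≢v
  ... | true  | _  = refl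
  ... | false | uv = contradiction uv ¬uv

  module _ {P : Pred (Fin n) 0ℓ} (P? : Decidable P) where

    #-out+in≤ : ∀ {v} → P v → # (P? ∩? out? v) + # (P? ∩? in? v) + 1 ≤ # P?
    #-out+in≤ {v} pv = begin
      # (P? ∩? out? v) + # (P? ∩? in? v) + 1
        ≤⟨ +-mono-≤ (#-disjoint (P? ∩? out? v) (P? ∩? in? v) (P? ∩? ∁? (_≟ᶠ v))
                      (λ { (p , vw) → p , λ { refl → ⟶⇒≢ vw refl } })
                      (λ { (p , wv) → p , λ { refl → ⟶⇒≢ wv refl } })
                      (λ { (_ , vw) (_ , wv) → ⟶-asym vw wv }))
                    (≤-reflexive (sym (#-≡ v))) ⟩
      # (P? ∩? ∁? (_≟ᶠ v)) + # (_≟ᶠ v)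
        ≤⟨ #-disjoint (P? ∩? ∁? (_≟ᶠ v)) (_≟ᶠ v) P? proj₁ (λ { refl → pv }) proj₂ ⟩
      # P? ∎
      where open ≤-Reasoning

    #-out+in≥ : ∀ v → # P? ≤ # (P? ∩? out? v) + # (P? ∩? in? v) + 1
    #-out+in≥ v = begin
      # P?                       ≤⟨ #-delete P? v ⟩
      1 + # (P? ∩? ∁? (_≟ᶠ v))   ≤⟨ s≤s (#-∪ (P? ∩? ∁? (_≟ᶠ v)) (P? ∩? out? v) (P? ∩? in? v) cover) ⟩
      1 + (# (P? ∩? out? v) + # (P? ∩? in? v)) ≡⟨ +-comm 1 _ ⟩
      # (P? ∩? out? v) + # (P? ∩? in? v) + 1 ∎
      where
      open ≤-Reasoning
      cover : ∀ {w} → _ × w ≢ v → (_ × v ⟶ w) ⊎ (_ × w ⟶ v)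
      cover {w} (pw , w≢v) with v ⟶? w
      ... | yes vw = inj₁ (pw , vw)
      ... | no ¬vw = inj₂ (pw , ⟶-total (w≢v ∘ sym) ¬vw)

    opaque
     unfolding #_

     -- Both sides count the arcs inside `P`, once by their heads and once by their tails.
     handshake : sum (λ v → ⟦ does (P? v) ⟧ * # (P? ∩? in? v))
               ≡ sum (λ v → ⟦ does (P? v) ⟧ * # (P? ∩? out? v))
     handshake = begin
       sum (λ v → ⟦ does (P? v) ⟧ * # (P? ∩? in? v))
         ≡⟨ sum-cong-≗ (λ v → *-distribˡ-sum {n} ⟦ does (P? v) ⟧ _) ⟩
       sum (λ v → sum (λ z → ⟦ does (P? v) ⟧ * ⟦ does ((P? ∩? in? v) z) ⟧))
         ≡⟨ ∑-comm {n} {n} _ ⟩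
       sum (λ z → sum (λ v → ⟦ does (P? v) ⟧ * ⟦ does ((P? ∩? in? v) z) ⟧))
         ≡⟨ sum-cong-≗ (λ z → sum-cong-≗ (λ v → exchange (does (P? v)) (does (P? z)) _)) ⟩
       sum (λ z → sum (λ v → ⟦ does (P? z) ⟧ * ⟦ does ((P? ∩? out? z) v) ⟧))
         ≡⟨ sum-cong-≗ (λ z → *-distribˡ-sum {n} ⟦ does (P? z) ⟧ _) ⟨
       sum (λ z → ⟦ does (P? z) ⟧ * # (P? ∩? out? z)) ∎
       where
       open ≡-Reasoning
       exchange : ∀ a b c → ⟦ a ⟧ * ⟦ b ∧ c ⟧ ≡ ⟦ b ⟧ * ⟦ a ∧ c ⟧
       exchange false false _ = refl
       exchange false true  _ = refl
       exchange true  false _ = refl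
       exchange true  true  _ = refl

     -- If the in-degree within `P` exceeded the out-degree at every vertex of `P`, summation would
     -- contradict `handshake`.
     ∃-in≤out : ∃ P → ∃ λ v → P v × # (P? ∩? in? v) ≤ # (P? ∩? out? v)
     ∃-in≤out (v₀ , pv₀) with any? (λ v → P? v ×-dec # (P? ∩? in? v) ≤? # (P? ∩? out? v))
     ... | yes v = v
     ... | no ¬v = ⊥-elim (<⇒≱ strict (≤-reflexive handshake))
       where
       pointwise : ∀ v → ⟦ does (P? v) ⟧ + ⟦ does (P? v) ⟧ * # (P? ∩? out? v)
                       ≤ ⟦ does (P? v) ⟧ * # (P? ∩? in? v)
       pointwise v with P? v | ¬v ∘ (v ,_)
       ... | no  _  | _ = z≤n
       ... | yes pv | ¬in≤out = begin
         1 + 1 * # (P? ∩? out? v) ≡⟨ cong suc (*-identityˡ _) ⟩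
         1 + # (P? ∩? out? v)     ≤⟨ ≰⇒> (¬in≤out ∘ (pv ,_)) ⟩
         # (P? ∩? in? v)          ≡⟨ *-identityˡ _ ⟨
         1 * # (P? ∩? in? v) ∎
         where open ≤-Reasoning
       strict : sum (λ v → ⟦ does (P? v) ⟧ * # (P? ∩? out? v))
              < sum (λ v → ⟦ does (P? v) ⟧ * # (P? ∩? in? v))
       strict = ≤-trans (+-monoˡ-≤ _ (#-∃ P? (v₀ , pv₀)))
         (≤-trans (≤-reflexive (sym (∑-distrib-+ {n} _ _))) (sum-mono-≤ {n} pointwise))

    ∃-low-in : ∃ P → ∃ λ v → P v × 2 * # (P? ∩? in? v) + 1 ≤ # P?
    ∃-low-in ∃P with v , pv , in≤out ← ∃-in≤out ∃P = v , pv , (begin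
      2 * # (P? ∩? in? v) + 1 ≡⟨ cong (_+ 1) (cong (# (P? ∩? in? v) +_) (+-identityʳ _)) ⟩
      # (P? ∩? in? v) + # (P? ∩? in? v) + 1 ≤⟨ +-monoˡ-≤ 1 (+-monoˡ-≤ _ in≤out) ⟩
      # (P? ∩? out? v) + # (P? ∩? in? v) + 1 ≤⟨ #-out+in≤ pv ⟩
      # P? ∎)
      where open ≤-Reasoning

    ∃-high-out : ∃ P → ∃ λ v → P v × # P? ≤ 2 * # (P? ∩? out? v) + 1
    ∃-high-out ∃P with v , pv , in≤out ← ∃-in≤out ∃P = v , pv , (begin
      # P? ≤⟨ #-out+in≥ v ⟩
      # (P? ∩? out? v) + # (P? ∩? in? v) + 1 ≤⟨ +-monoˡ-≤ 1 (+-monoʳ-≤ _ in≤out) ⟩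
      # (P? ∩? out? v) + # (P? ∩? out? v) + 1 ≡⟨ cong (_+ 1) (cong (# (P? ∩? out? v) +_) (+-identityʳ _)) ⟨
      2 * # (P? ∩? out? v) + 1 ∎)
      where open ≤-Reasoning

    -- The averaging tool: some vertex of `P` is dominated by at most half of the other members, so
    -- a uniform lower bound on in-degrees doubles into one on the size of `P`. In applications `k`
    -- counts 2-paths and `c` those of their midpoints that may lie outside `P`.
    in-degrees⇒large : ∀ c k → ∃ P → (∀ v → P v → k ≤ c + # (P? ∩? in? v)) →
                       2 * k + 1 ≤ # P? + 2 * c
    in-degrees⇒large c k ∃P k≤ with v , pv , low ← ∃-low-in ∃P = begin
      2 * k + 1 ≤⟨ +-monoˡ-≤ 1 (*-monoʳ-≤ 2 (k≤ v pv)) ⟩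
      2 * (c + # (P? ∩? in? v)) + 1 ≡⟨ rearrange c (# (P? ∩? in? v)) ⟩
      2 * # (P? ∩? in? v) + 1 + 2 * c ≤⟨ +-monoˡ-≤ _ low ⟩
      # P? + 2 * c ∎
      where
      open ≤-Reasoning
      rearrange : ∀ c d → 2 * (c + d) + 1 ≡ 2 * d + 1 + 2 * c
      rearrange = solve-∀

  out+in≥ : ∀ u → n ≤ # (out? u) + # (in? u) + 1
  out+in≥ u = begin
    n    ≡⟨ #-U ⟨
    # (U? {A = Fin n}) ≤⟨ #-out+in≥ U? u ⟩
    # (U? ∩? out? u) + # (U? ∩? in? u) + 1
      ≤⟨ #-mono (U? ∩? out? u) (out? u) proj₂ ⊕ #-mono (U? ∩? in? u) (in? u) proj₂ ⊕ ≤-refl ⟩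
    # (out? u) + # (in? u) + 1 ∎
    where open ≤-Reasoning

  out+in≤ : ∀ u → # (out? u) + # (in? u) + 1 ≤ n
  out+in≤ u = begin
    # (out? u) + # (in? u) + 1
      ≤⟨ #-mono (out? u) (U? ∩? out? u) (tt ,_) ⊕ #-mono (in? u) (U? ∩? in? u) (tt ,_) ⊕ ≤-refl ⟩
    # (U? ∩? out? u) + # (U? ∩? in? u) + 1 ≤⟨ #-out+in≤ U? tt ⟩
    # (U? {A = Fin n}) ≡⟨ #-U ⟩
    n ∎
    where open ≤-Reasoning

-- Reversal, and the degree bounds that follow from the hypotheses

op : Tournament n → Tournament n
op T = record { arc = flip (arc T) ; irrefl = irrefl T ; tourn = λ u v u≢v → tourn T v u (u≢v ∘ sym) }

module _ {n} (T : Tournament n) {P : Pred (Fin n) 0ℓ} (P? : Decidable P) where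
  open Arrows T

  out-degrees⇒large : ∀ c k → ∃ P → (∀ v → P v → k ≤ c + # (P? ∩? out? v)) →
                      2 * k + 1 ≤ # P? + 2 * c
  out-degrees⇒large = Arrows.in-degrees⇒large (op T) P?

  ∃-high-in : ∃ P → ∃ λ v → P v × # P? ≤ 2 * # (P? ∩? in? v) + 1
  ∃-high-in = Arrows.∃-high-out (op T) P?

-- The hypotheses cleared of fractions: `gap` is i < 2π - (n + 8)/6 multiplied by 6, with strictness
-- turning 8 into 9. The record is closed under reversal, so every consequence is also available for
-- `op T`.
record Bounds (T : Tournament n) (π i : ℕ) : Set where
  open Arrows T
  field
    paths     : ∀ {u v} → u ≢ v → π ≤ # (out? u ∩? in? v)
    out-bound : ∀ u → 2 * # (out? u) + 1 ≤ n + i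
    in-bound  : ∀ u → 2 * # (in? u) + 1 ≤ n + i
    gap       : 6 * i + n + 9 ≤ 12 * π
    size      : 9 ≤ n

op-bounds : ∀ {T : Tournament n} {π i} → Bounds T π i → Bounds (op T) π i
op-bounds {T = T} b = record
  { paths     = λ u≢v → ≤-trans (paths (u≢v ∘ sym)) (#-mono (out? _ ∩? in? _) (in? _ ∩? out? _) swap)
  ; out-bound = in-bound
  ; in-bound  = out-bound
  ; gap       = gap
  ; size      = size
  }
  where
  open Arrows T
  open Bounds b

module Degrees {n} {T : Tournament n} {π i : ℕ} (b : Bounds T π i) where
  open Arrows T
  open Bounds b

  2≤π : 2 ≤ π
  2≤π = *-cancelˡ-< 12 1 π (begin
    13             ≤⟨ m≤m+n 13 5 ⟩
    9 + 9          ≤⟨ +-monoˡ-≤ 9 size ⟩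
    n + 9          ≤⟨ m≤n+m (n + 9) (6 * i) ⟩
    6 * i + (n + 9) ≡⟨ +-assoc (6 * i) n 9 ⟨
    6 * i + n + 9  ≤⟨ gap ⟩
    12 * π ∎)
    where open ≤-Reasoning

  i+3≤2π : i + 3 ≤ 2 * π
  i+3≤2π = *-cancelˡ-≤ 6 (begin
    6 * (i + 3)   ≡⟨ solve (i ∷ []) ⟩
    6 * i + 9 + 9 ≤⟨ +-monoˡ-≤ 9 (+-monoʳ-≤ (6 * i) size) ⟩
    6 * i + n + 9 ≤⟨ gap ⟩
    12 * π        ≡⟨ *-assoc 6 2 π ⟩
    6 * (2 * π) ∎)
    where open ≤-Reasoning

  -- All out-degrees lie between (n - 1 - i)/2 and (n - 1 + i)/2.
  out-gap : ∀ u v → # (out? u) ≤ # (out? v) + i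
  out-gap u v = linear (# (out? u)) (# (out? v)) (# (in? v)) (out-bound u) (out+in≥ v) (in-bound v)
    where
    linear : ∀ a c d → 2 * a + 1 ≤ n + i → n ≤ c + d + 1 → 2 * d + 1 ≤ n + i → a ≤ c + i
    linear a c d h₁ h₂ h₃ = by-combination 1 1 (h₁ ⊕ 2 ⊛ h₂ ⊕ h₃)
      (solve (a ∷ c ∷ d ∷ n ∷ i ∷ []))

  ∃-path : ∀ {u v} → u ≢ v → ∃ λ y → u ⟶ y × y ⟶ v
  ∃-path {u} {v} u≢v = #-inhabited (out? u ∩? in? v) (≤-trans (≤-trans (s≤s z≤n) 2≤π) (paths u≢v))

  -- The midpoints of the 2-paths from `u` to one of its out-neighbours are themselves
  -- out-neighbours of `u`, so averaging applies inside the out-neighbourhood.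
  2π+1≤out : ∀ {u v} → u ≢ v → 2 * π + 1 ≤ # (out? u)
  2π+1≤out {u} u≢v with y , uy , _ ← ∃-path u≢v = subst (2 * π + 1 ≤_) (+-identityʳ _)
    (in-degrees⇒large (out? u) 0 π (y , uy) (λ v → paths ∘ ⟶⇒≢))

-- The case in which one end of the path dominates everything outside

-- In the application B is the vertex set of the path, and f and l are its ends, in either order.
module OneSided {n} {T : Tournament n} {π i : ℕ} (b : Bounds T π i)
  {B : Pred (Fin n) 0ℓ} (B? : Decidable B) {f l : Fin n} where
  open Arrows T

  module _
    (f∈B : B f) (l∈B : B l)
    (f-first : ∀ {z u} → ¬ B z → B u → f ⟶ z → u ⟶ z)
    (l-wins : ∀ {z} → ¬ B z → l ⟶ z)
    where
    open Bounds b
    open Degrees b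

    Low? = ∁? B? ∩? out? f
    Mid? = ∁? B? ∩? in? f

    outside : ∀ {y} → ¬ B y → f ⟶ y ⊎ y ⟶ f
    outside {y} y∉B with f ⟶? y
    ... | yes fy = inj₁ fy
    ... | no ¬fy = inj₂ (⟶-total (λ { refl → y∉B f∈B }) ¬fy)

    beyond : ∀ {u y} → ¬ B u → f ⟶ u → u ⟶ y → ¬ B y
    beyond u∉B fu uy y∈B = ⟶-asym uy (f-first u∉B y∈B fu)

    -- By `f-first` all of `B` dominates `u`, so every 2-path from `u` to `f` has its midpoint
    -- outside `B`.
    π≤mid : ∀ {u} → ¬ B u → f ⟶ u → π ≤ # (Mid? ∩? out? u)
    π≤mid {u} u∉B fu = ≤-trans (paths (⟶⇒≢ fu ∘ sym))
      (#-mono (out? u ∩? in? f) (Mid? ∩? out? u) λ { (uy , yf) → (beyond u∉B fu uy , yf) , uy })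

    module Witness (mid≤ : # Mid? ≤ i + 2) {w v : Fin n} (w∉B : ¬ B w) (fw : f ⟶ w)
      (v∉B : ¬ B v) (fv : f ⟶ v) (wv : w ⟶ v) where

      N₁? = Low? ∩? in? v
      N₂? = Mid? ∩? in? v

      -- A 2-path from a vertex of `N₁?` to `v` has its midpoint outside `B`, hence in `N₁?` or
      -- `N₂?`; averaging inside `N₁?` counts `N₂?` twice.
      n₁-large : 2 * π + 1 ≤ # N₁? + 2 * # N₂?
      n₁-large = out-degrees⇒large T N₁? (# N₂?) π (w , (w∉B , fw) , wv) λ u n₁u →
        ≤-trans (paths (⟶⇒≢ (proj₂ n₁u)))
          (#-∪ (out? u ∩? in? v) N₂? (N₁? ∩? out? u) (split u (proj₁ n₁u)))
        where
        split : ∀ u → ¬ B u × f ⟶ u → ∀ {y} → u ⟶ y × y ⟶ v →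
                ((¬ B y × y ⟶ f) × y ⟶ v) ⊎ (((¬ B y × f ⟶ y) × y ⟶ v) × u ⟶ y)
        split u (u∉B , fu) (uy , yv) with y∉B ← beyond u∉B fu uy with outside y∉B
        ... | inj₁ fy = inj₂ (((y∉B , fy) , yv) , uy)
        ... | inj₂ yf = inj₁ ((y∉B , yf) , yv)

      mid-split : # N₂? + # (Mid? ∩? out? v) ≤ # Mid?
      mid-split = #-disjoint N₂? (Mid? ∩? out? v) Mid? proj₁ proj₁
        λ { (_ , yv) (_ , vy) → ⟶-asym yv vy }

      in-v : # B? + (# N₁? + # N₂?) ≤ # (in? v)
      in-v = ≤-trans (+-monoʳ-≤ (# B?) (#-disjoint N₁? N₂? (∁? B? ∩? in? v)
                        (λ { ((y∉B , _) , yv) → y∉B , yv }) (λ { ((y∉B , _) , yv) → y∉B , yv })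
                        λ { ((_ , fy) , _) ((_ , yf) , _) → ⟶-asym fy yf }))
        (#-disjoint B? (∁? B? ∩? in? v) (in? v)
          (λ y∈B → f-first v∉B y∈B fv) proj₂ λ { y∈B (y∉B , _) → y∉B y∈B })

      in-l : # (in? l) < # B?
      in-l = #-⊊ (in? l) B? ⊆B l∈B (λ ll → ⟶⇒≢ ll refl)
        where
        ⊆B : ∀ {y} → y ⟶ l → B y
        ⊆B {y} yl with B? y
        ... | yes y∈B = y∈B
        ... | no  y∉B = ⊥-elim (⟶-asym yl (l-wins y∉B))

      4π+3≤n : 4 * π + 3 ≤ n
      4π+3≤n = linear (# (out? w)) (# (in? w)) (2π+1≤out (⟶⇒≢ fw ∘ sym))
        (Degrees.2π+1≤out (op-bounds b) (⟶⇒≢ fw ∘ sym)) (out+in≤ w)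
        where
        linear : ∀ o d → 2 * π + 1 ≤ o → 2 * π + 1 ≤ d → o + d + 1 ≤ n → 4 * π + 3 ≤ n
        linear o d h₁ h₂ h₃ = by-combination 0 0 (h₁ ⊕ h₂ ⊕ h₃) (solve (o ∷ d ∷ π ∷ n ∷ []))

      -- Since |B| > d⁻(l) ≥ (n - 1 - i)/2 and `v` has at most (n - 1 + i)/2 in-neighbours, n₁ + n₂
      -- ≤ i - 1. On the other hand n₂ ≤ i + 2 - π, so n₁ + n₂ ≥ 3π - 1 - i.
      combine : ∀ n₁ n₂ r x p d o e →
        2 * π + 1 ≤ n₁ + 2 * n₂ → n₂ + x ≤ r → π ≤ x → r ≤ i + 2 → p + (n₁ + n₂) ≤ d →
        2 * d + 1 ≤ n + i → n ≤ o + e + 1 → 2 * o + 1 ≤ n + i → suc e ≤ p → 3 * π ≤ 2 * i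
      combine n₁ n₂ r x p d o e h₁ h₂ h₃ h₄ h₅ h₆ h₇ h₈ h₉ = by-combination 1 1
        (2 ⊛ h₁ ⊕ 2 ⊛ h₂ ⊕ 2 ⊛ h₃ ⊕ 2 ⊛ h₄ ⊕ 2 ⊛ h₅ ⊕ h₆ ⊕ 2 ⊛ h₇ ⊕ h₈ ⊕ 2 ⊛ h₉)
        (solve (n₁ ∷ n₂ ∷ r ∷ x ∷ p ∷ d ∷ o ∷ e ∷ n ∷ i ∷ π ∷ []))

      clash : 4 * π + 3 ≤ n → 3 * π ≤ 2 * i → 6 * i + n + 9 ≤ 12 * π → ⊥
      -- The combination eliminates n and i and leaves 39π + 36 ≤ 36π.
      clash h₁ h₂ h₃ = exceeds⇒⊥ (3 * π + 35) (3 ⊛ h₁ ⊕ 9 ⊛ h₂ ⊕ 3 ⊛ h₃) (solve (n ∷ i ∷ π ∷ []))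

      absurd : ⊥
      absurd = clash 4π+3≤n
        (combine (# N₁?) (# N₂?) (# Mid?) (# (Mid? ∩? out? v)) (# B?) (# (in? v))
                 (# (out? l)) (# (in? l))
          n₁-large mid-split (π≤mid v∉B fv) mid≤ in-v (in-bound v) (out+in≥ l) (out-bound l) in-l)
        gap

    opaque
      -- All of `B` dominates `w`, so its 2π + 1 or more out-neighbours lie in `Low?` or `Mid?`, and
      -- `Mid?` has at most i + 2 < 2π elements.
      ∃-low-out : # Mid? ≤ i + 2 → ∀ {w} → ¬ B w → f ⟶ w → ∃ λ v → (¬ B v × f ⟶ v) × w ⟶ v
      ∃-low-out mid≤ {w} w∉B fw = #-inhabited (Low? ∩? out? w)
        (linear (# (Low? ∩? out? w)) (# Mid?) (# (out? w))
             (#-∪ (out? w) (Low? ∩? out? w) Mid? split) mid≤ (2π+1≤out (⟶⇒≢ fw ∘ sym)) i+3≤2π)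
        where
        split : ∀ {y} → w ⟶ y → ((¬ B y × f ⟶ y) × w ⟶ y) ⊎ (¬ B y × y ⟶ f)
        split wy with y∉B ← beyond w∉B fw wy with outside y∉B
        ... | inj₁ fy = inj₁ ((y∉B , fy) , wy)
        ... | inj₂ yf = inj₂ (y∉B , yf)
        linear : ∀ x r o → o ≤ x + r → r ≤ i + 2 → 2 * π + 1 ≤ o → i + 3 ≤ 2 * π → 1 ≤ x
        linear x r o h₁ h₂ h₃ h₄ = by-combination 0 1 (h₁ ⊕ h₂ ⊕ h₃ ⊕ h₄)
          (solve (x ∷ r ∷ o ∷ i ∷ π ∷ []))

    no-low : # Mid? ≤ i + 2 → ∀ {w} → ¬ B w → ¬ f ⟶ w
    no-low mid≤ w∉B fw with v , (v∉B , fv) , wv ← ∃-low-out mid≤ w∉B fw =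
      Witness.absurd mid≤ w∉B fw v∉B fv wv

-- Sets dominated by other sets

module Domination {n} {T : Tournament n} {π i : ℕ} (b : Bounds T π i) where
  open Arrows T
  open Bounds b

  -- Some `w` in `A` has at least (|A| - 1)/2 in-neighbours inside `A`, and all of `C` besides; its
  -- in-degree is at most (n - 1 + i)/2.
  dominated-bound : {A C : Pred (Fin n) 0ℓ} (A? : Decidable A) (C? : Decidable C) → ∃ A →
    (∀ {u w} → C u → A w → u ⟶ w) → 2 * # C? + # A? ≤ n + i
  dominated-bound A? C? ∃A C⟶A with w , aw , high ← ∃-high-in T A? ∃A =
    linear (# C?) (# A?) (# (A? ∩? in? w)) (# (in? w)) high
      (#-disjoint C? (A? ∩? in? w) (in? w) (λ cu → C⟶A cu aw) proj₂
        (λ { cu (au , _) → ⟶⇒≢ (C⟶A cu au) refl }))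
      (in-bound w)
    where
    linear : ∀ c a x d → a ≤ 2 * x + 1 → c + x ≤ d → 2 * d + 1 ≤ n + i → 2 * c + a ≤ n + i
    linear c a x d h₁ h₂ h₃ = by-combination 0 0 (h₁ ⊕ 2 ⊛ h₂ ⊕ h₃)
      (solve (c ∷ a ∷ x ∷ d ∷ n ∷ i ∷ []))

-- The counting contradiction from a vertex outside a nonextendable path

-- B is the vertex set of the path; f, f′, l′, l are its first, second, penultimate and last vertex.
-- In turn, h is the successor of g: the last vertex dominated by z and the first one dominating it.
module Core {n} {T : Tournament n} {π i : ℕ} (b : Bounds T π i)
  {B : Pred (Fin n) 0ℓ} (B? : Decidable B) {f f′ l′ l : Fin n} where
  open Arrows T

  module _
    (f∈B : B f) (f′∈B : B f′) (l′∈B : B l′) (l∈B : B l)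
    (f⟶f′ : f ⟶ f′) (l′⟶l : l′ ⟶ l) (f≢l : f ≢ l) (f′≢l : f′ ≢ l)
    (f-first  : ∀ {z u} → ¬ B z → B u → f ⟶ z → u ⟶ z)
    (f′-first : ∀ {z u} → ¬ B z → B u → u ≢ f → f′ ⟶ z → u ⟶ z)
    (l-last   : ∀ {z u} → ¬ B z → B u → z ⟶ l → z ⟶ u)
    (l′-last  : ∀ {z u} → ¬ B z → B u → u ≢ l → z ⟶ l′ → z ⟶ u)
    -- Later path vertices dominate every outside vertex that earlier ones dominate, so these sets
    -- form a chain.
    (ordered  : ∀ {u v} → B u → B v →
                (∀ {z} → ¬ B z → u ⟶ z → v ⟶ z) ⊎ (∀ {z} → ¬ B z → v ⟶ z → u ⟶ z))
    (balance  : ∀ {z} → ¬ B z → z ⟶ f′ → l′ ⟶ z → # (B? ∩? out? f) ≤ # (B? ∩? out? l) + 2)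
    (turn     : ∀ {z} → ¬ B z → z ⟶ f → l ⟶ z → ∃ λ g → ∃ λ h → z ⟶ g × h ⟶ z × B g × B h ×
                (# (B? ∩? (out? z ∩? in? h)) ≤ 1 ⊎ # (B? ∩? (out? g ∩? in? z)) ≤ 1))
    where
    open Bounds b
    open Degrees b
    open Domination

    ≢-outside : ∀ {z u} → ¬ B z → B u → z ≢ u
    ≢-outside z∉B u∈B refl = z∉B u∈B

    ¬⟶ʳ : ∀ {z u} → ¬ B z → B u → ¬ z ⟶ u → u ⟶ z
    ¬⟶ʳ z∉B u∈B = ⟶-total (≢-outside z∉B u∈B)

    ¬⟶ˡ : ∀ {z u} → ¬ B z → B u → ¬ u ⟶ z → z ⟶ u
    ¬⟶ˡ z∉B u∈B = ⟶-total (≢-outside z∉B u∈B ∘ sym)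

    n≤B+∁B : n ≤ # B? + # (∁? B?)
    n≤B+∁B = subst (_≤ # B? + # (∁? B?)) #-U (#-∪ U? B? (∁? B?) (λ {v} _ → split v))
      where
      split : ∀ v → B v ⊎ ¬ B v
      split v with B? v
      ... | yes p = inj₁ p
      ... | no ¬p = inj₂ ¬p

    B-inside : ∀ {y} → (¬ B y → ⊥) → B y
    B-inside {y} = decidable-stable (B? y)

    module NoMiddle (¬M : ∀ {z} → ¬ B z → z ⟶ f′ → ¬ l′ ⟶ z) {z₀ : Fin n} (z₀∉B : ¬ B z₀) where

      Low?  = ∁? B? ∩? out? f′
      High? = ∁? B? ∩? in? l′

      -- Otherwise `f′` dominates everything outside, and every 2-path from `z₀` to `f′` passes
      -- through `f`, against π ≥ 2.
      ∃High : ∃ λ z → ¬ B z × z ⟶ l′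
      ∃High with any? High?
      ... | yes z = z
      ... | no ¬high = ⊥-elim (1+n≰n (≤-trans 2≤π (≤-trans (paths (≢-outside z₀∉B f′∈B))
                         (#-subsingleton (out? z₀ ∩? in? f′) f only-f))))
        where
        f′-wins : ∀ {z} → ¬ B z → f′ ⟶ z
        f′-wins z∉B = ¬⟶ʳ z∉B f′∈B λ zf′ → ¬M z∉B zf′ (¬⟶ʳ z∉B l′∈B λ zl′ → ¬high (_ , z∉B , zl′))
        only-f : ∀ y → z₀ ⟶ y × y ⟶ f′ → y ≡ f
        only-f y (zy , yf′) = decidable-stable (y ≟ᶠ f) λ y≢f →
          ⟶-asym zy (f′-first z₀∉B (B-inside λ y∉B → ⟶-asym yf′ (f′-wins y∉B)) y≢f (f′-wins z₀∉B))

      ∃Low : ∃ λ z → ¬ B z × f′ ⟶ z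
      ∃Low with any? Low?
      ... | yes z = z
      ... | no ¬low = ⊥-elim (1+n≰n (≤-trans 2≤π (≤-trans (paths (≢-outside z₀∉B l′∈B ∘ sym))
                        (#-subsingleton (out? l′ ∩? in? z₀) l only-l))))
        where
        l′-loses : ∀ {z} → ¬ B z → z ⟶ l′
        l′-loses z∉B = ¬⟶ˡ z∉B l′∈B (¬M z∉B (¬⟶ˡ z∉B f′∈B λ f′z → ¬low (_ , z∉B , f′z)))
        only-l : ∀ y → l′ ⟶ y × y ⟶ z₀ → y ≡ l
        only-l y (l′y , yz) = decidable-stable (y ≟ᶠ l) λ y≢l →
          ⟶-asym yz (l′-last z₀∉B (B-inside λ y∉B → ⟶-asym l′y (l′-loses y∉B)) y≢l (l′-loses z₀∉B))

      -- An outside vertex dominated by `f′` is dominated by every path vertex other than `f`, and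
      -- `f` is no out-neighbour of `f′`. So the 2-paths from `f′` to its out-neighbours in `B` stay
      -- in `B`.
      out-f′ : 2 * π + 1 ≤ # (B? ∩? out? f′)
      out-f′ = subst (2 * π + 1 ≤_) (+-identityʳ _)
        (in-degrees⇒large (B? ∩? out? f′) 0 π nonempty λ { v (v∈B , f′v) →
          ≤-trans (paths (⟶⇒≢ f′v)) (#-mono (out? f′ ∩? in? v) ((B? ∩? out? f′) ∩? in? v)
            λ { (f′y , yv) → (B-inside (λ y∉B → ⟶-asym yv
                  (f′-first y∉B v∈B (λ { refl → ⟶-asym f⟶f′ f′v }) f′y)) , f′y) , yv }) })
        where
        nonempty : ∃ λ y → B y × f′ ⟶ y
        nonempty with y , f′y , yl ← ∃-path f′≢l =
          y , B-inside (λ y∉B → ⟶-asym f′y (l-last y∉B f′∈B yl)) , f′y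

      -- A 2-path from `l` to `f′` may leave `B`, so `l` is excluded from `N?`. As a possible
      -- midpoint it then costs 1 for each vertex, which doubles to 2.
      in-f′ : 2 * π + 1 ≤ # (B? ∩? in? f′) + 2
      in-f′ = ≤-trans
        (out-degrees⇒large T N? 1 π (f , (f∈B , f⟶f′) , f≢l) λ { v ((v∈B , vf′) , v≢l) →
          ≤-trans (paths (⟶⇒≢ vf′)) (≤-trans
            (#-∪ (out? v ∩? in? f′) (_≟ᶠ l) (N? ∩? out? v) (split v∈B v≢l))
            (+-monoˡ-≤ _ (≤-reflexive (#-≡ l)))) })
        (+-monoˡ-≤ 2 (#-mono N? (B? ∩? in? f′) proj₁))
        where
        N? = (B? ∩? in? f′) ∩? ∁? (_≟ᶠ l)
        split : ∀ {v} → B v → v ≢ l → ∀ {y} → v ⟶ y × y ⟶ f′ →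
                y ≡ l ⊎ (((B y × y ⟶ f′) × y ≢ l) × v ⟶ y)
        split v∈B v≢l {y} (vy , yf′) with y ≟ᶠ l
        ... | yes y≡l = inj₁ y≡l
        ... | no  y≢l = inj₂ (((B-inside (λ y∉B → ⟶-asym vy
                  (l′-last y∉B v∈B v≢l (¬⟶ˡ y∉B l′∈B (¬M y∉B yf′)))) , yf′) , y≢l) , vy)

      covered : # (∁? B?) ≤ # Low? + # High?
      covered = #-∪ (∁? B?) Low? High? λ {z} → split z
        where
        split : ∀ z → ¬ B z → (¬ B z × f′ ⟶ z) ⊎ (¬ B z × z ⟶ l′)
        split z z∉B with f′ ⟶? z
        ... | yes f′z = inj₁ (z∉B , f′z)
        ... | no ¬f′z = inj₂ (z∉B , ¬⟶ˡ z∉B l′∈B (¬M z∉B (¬⟶ˡ z∉B f′∈B ¬f′z)))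

      -- The neighbours of `f′` give p ≥ 4π + 1; the two domination bounds give 3p ≤ n + 2i + 4.
      combine : ∀ p q c d α β x y →
        2 * π + 1 ≤ x → 2 * π + 1 ≤ y + 2 → x + y + 1 ≤ p → p ≤ 1 + c → p ≤ 1 + d →
        2 * c + α ≤ n + i → 2 * d + β ≤ n + i → n ≤ p + q → q ≤ α + β →
        6 * i + n + 9 ≤ 12 * π → ⊥
      combine p q c d α β x y h₁ h₂ h₃ h₄ h₅ h₆ h₇ h₈ h₉ h₀ = exceeds⇒⊥ (4 * i + 7)
        (3 ⊛ h₁ ⊕ 3 ⊛ h₂ ⊕ 3 ⊛ h₃ ⊕ 2 ⊛ h₄ ⊕ 2 ⊛ h₅ ⊕ h₆ ⊕ h₇ ⊕ h₈ ⊕ h₉ ⊕ h₀)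
        (solve (p ∷ q ∷ c ∷ d ∷ α ∷ β ∷ x ∷ y ∷ n ∷ i ∷ π ∷ []))

      absurd : ⊥
      absurd = combine (# B?) (# (∁? B?)) (# (B? ∩? ∁? (_≟ᶠ f))) (# (B? ∩? ∁? (_≟ᶠ l)))
        (# Low?) (# High?) (# (B? ∩? out? f′)) (# (B? ∩? in? f′))
        out-f′ in-f′ (#-out+in≤ B? f′∈B) (#-delete B? f) (#-delete B? l)
        (dominated-bound b Low? (B? ∩? ∁? (_≟ᶠ f)) ∃Low
          λ { (u∈B , u≢f) (z∉B , f′z) → f′-first z∉B u∈B u≢f f′z })
        (dominated-bound (op-bounds b) High? (B? ∩? ∁? (_≟ᶠ l)) ∃High
          λ { (u∈B , u≢l) (z∉B , zl′) → l′-last z∉B u∈B u≢l zl′ })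
        n≤B+∁B covered gap

    module Middle {m : Fin n} (m∉B : ¬ B m) (mf′ : m ⟶ f′) (l′m : l′ ⟶ m) where

      Low?  = ∁? B? ∩? out? f
      High? = ∁? B? ∩? in? l
      Mid?  = ∁? B? ∩? (in? f ∩? out? l)

      -- `Low?` contributes to the out-degrees of both ends, `Mid?` only to that of `l`. The totals
      -- are compared by `out-gap` and the parts inside `B` by `balance`.
      mid≤ : # Mid? ≤ i + 2
      mid≤ = linear (# (B? ∩? out? f)) (# (B? ∩? out? l)) (# Low?) (# Mid?) (# (out? f)) (# (out? l))
        (#-∪ (out? f) (B? ∩? out? f) Low? λ {y} → split y)
        (≤-trans (+-monoʳ-≤ (# (B? ∩? out? l)) (#-disjoint Low? Mid? (∁? B? ∩? out? l)
            (λ { (y∉B , fy) → y∉B , f-first y∉B l∈B fy })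
            (λ { (y∉B , _ , ly) → y∉B , ly })
            λ { (_ , fy) (_ , yf , _) → ⟶-asym fy yf }))
          (#-disjoint (B? ∩? out? l) (∁? B? ∩? out? l) (out? l) proj₂ proj₂
            λ { (y∈B , _) (y∉B , _) → y∉B y∈B }))
        (out-gap l f) (balance m∉B mf′ l′m)
        where
        split : ∀ y → f ⟶ y → (B y × f ⟶ y) ⊎ (¬ B y × f ⟶ y)
        split y fy with B? y
        ... | yes y∈B = inj₁ (y∈B , fy)
        ... | no  y∉B = inj₂ (y∉B , fy)
        linear : ∀ x y α ρ o o′ → o ≤ x + α → y + (α + ρ) ≤ o′ → o′ ≤ o + i → x ≤ y + 2 → ρ ≤ i + 2
        linear x y α ρ o o′ h₁ h₂ h₃ h₄ = by-combination 0 0 (h₁ ⊕ h₂ ⊕ h₃ ⊕ h₄)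
          (solve (x ∷ y ∷ α ∷ ρ ∷ o ∷ o′ ∷ i ∷ []))

      out-f : 2 * π + 1 ≤ # (B? ∩? out? f)
      out-f = subst (2 * π + 1 ≤_) (+-identityʳ _)
        (in-degrees⇒large (B? ∩? out? f) 0 π (f′ , f′∈B , f⟶f′) λ { v (v∈B , fv) →
          ≤-trans (paths (⟶⇒≢ fv)) (#-mono (out? f ∩? in? v) ((B? ∩? out? f) ∩? in? v)
            λ { (fy , yv) → (B-inside (λ y∉B → ⟶-asym yv (f-first y∉B v∈B fy)) , fy) , yv }) })

      in-l : 2 * π + 1 ≤ # (B? ∩? in? l)
      in-l = subst (2 * π + 1 ≤_) (+-identityʳ _)
        (out-degrees⇒large T (B? ∩? in? l) 0 π (l′ , l′∈B , l′⟶l) λ { v (v∈B , vl) →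
          ≤-trans (paths (⟶⇒≢ vl)) (#-mono (out? v ∩? in? l) ((B? ∩? in? l) ∩? out? v)
            λ { (vy , yl) → (B-inside (λ y∉B → ⟶-asym vy (l-last y∉B v∈B yl)) , yl) , vy }) })

      covered : # (∁? B?) ≤ # Low? + (# High? + # Mid?)
      covered = ≤-trans (#-∪ (∁? B?) Low? (∁? B? ∩? in? f) λ {z} → split₁ z)
        (+-monoʳ-≤ (# Low?) (#-∪ (∁? B? ∩? in? f) High? Mid? λ {z} → split₂ z))
        where
        split₁ : ∀ z → ¬ B z → (¬ B z × f ⟶ z) ⊎ (¬ B z × z ⟶ f)
        split₁ z z∉B with f ⟶? z
        ... | yes fz = inj₁ (z∉B , fz)
        ... | no ¬fz = inj₂ (z∉B , ¬⟶ˡ z∉B f∈B ¬fz)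
        split₂ : ∀ z → ¬ B z × z ⟶ f → (¬ B z × z ⟶ l) ⊎ (¬ B z × z ⟶ f × l ⟶ z)
        split₂ z (z∉B , zf) with z ⟶? l
        ... | yes zl = inj₁ (z∉B , zl)
        ... | no ¬zl = inj₂ (z∉B , zf , ¬⟶ʳ z∉B l∈B ¬zl)

      -- The neighbours of `l` give p ≥ 4π + 1, its out-neighbours being compared with those of `f`;
      -- the other inequalities give 3p ≤ n + 3i + 2.
      combine : ∀ p q α β ρ x y z → 2 * π + 1 ≤ x → x ≤ y + 2 → 2 * π + 1 ≤ z → y + z + 1 ≤ p →
        2 * p + α ≤ n + i → 2 * p + β ≤ n + i → n ≤ p + q → q ≤ α + (β + ρ) → ρ ≤ i + 2 →
        6 * i + n + 9 ≤ 12 * π → ⊥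
      combine p q α β ρ x y z h₁ h₂ h₃ h₄ h₅ h₆ h₇ h₈ h₉ h₀ = exceeds⇒⊥ (3 * i + 9)
        (3 ⊛ h₁ ⊕ 3 ⊛ h₂ ⊕ 3 ⊛ h₃ ⊕ 3 ⊛ h₄ ⊕ h₅ ⊕ h₆ ⊕ h₇ ⊕ h₈ ⊕ h₉ ⊕ h₀)
        (solve (p ∷ q ∷ α ∷ β ∷ ρ ∷ x ∷ y ∷ z ∷ n ∷ i ∷ π ∷ []))

      module AllMiddle (f-loses : ∀ {z} → ¬ B z → z ⟶ f) (l-wins : ∀ {z} → ¬ B z → l ⟶ z)
        {w : Fin n} (w∉B : ¬ B w) (least : ∀ z → ¬ B z → # (B? ∩? out? w) ≤ # (B? ∩? out? z)) where

        -- By `ordered`, the out-neighbourhoods in `B` of the outside vertices are nested, so the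
        -- smallest one, that of `w`, lies in all of them.
        w-below : ∀ {z u} → ¬ B z → B u → w ⟶ u → z ⟶ u
        w-below {z} {u} z∉B u∈B wu with z ⟶? u
        ... | yes zu = zu
        ... | no ¬zu = ⊥-elim (<⇒≱ (#-⊊ (B? ∩? out? z) (B? ∩? out? w)
                (λ { (v∈B , zv) → v∈B , wv v∈B zv }) (u∈B , wu) (λ { (_ , zu) → ¬zu zu }))
                (least z z∉B))
          where
          uz : u ⟶ z
          uz = ¬⟶ʳ z∉B u∈B ¬zu
          wv : ∀ {v} → B v → z ⟶ v → w ⟶ v
          wv v∈B zv with ordered u∈B v∈B
          ... | inj₁ uv = ⊥-elim (⟶-asym zv (uv z∉B uz))
          ... | inj₂ vu = ¬⟶ˡ w∉B v∈B λ vw → ⟶-asym wu (vu w∉B vw)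

        N? = ∁? B? ∩? out? w

        -- If at most one 2-path from `w` to `h` runs inside `B`, then π ≥ 2 forces one outside. The
        -- alternative fails: by `w-below` every outside vertex dominates `g`, so all 2-paths from
        -- `g` to `w` stay in `B`, and there are at least two.
        ∃N : ∃ λ z → ¬ B z × w ⟶ z
        ∃N with g , h , wg , hw , g∈B , h∈B , few ← turn w∉B (f-loses w∉B) (l-wins w∉B) = by few
          where
          split : ∀ {y} → w ⟶ y × y ⟶ h → (B y × w ⟶ y × y ⟶ h) ⊎ (¬ B y × w ⟶ y)
          split {y} (wy , yh) with B? y
          ... | yes y∈B = inj₁ (y∈B , wy , yh)
          ... | no  y∉B = inj₂ (y∉B , wy)
          by : (# (B? ∩? (out? w ∩? in? h)) ≤ 1 ⊎ # (B? ∩? (out? g ∩? in? w)) ≤ 1) →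
               ∃ λ z → ¬ B z × w ⟶ z
          by (inj₁ few) = #-inhabited N? (+-cancelˡ-≤ 1 _ _ (≤-trans 2≤π (≤-trans
            (paths (≢-outside w∉B h∈B)) (≤-trans
              (#-∪ (out? w ∩? in? h) (B? ∩? (out? w ∩? in? h)) N? split)
              (+-monoˡ-≤ _ few)))))
          by (inj₂ few) = ⊥-elim (1+n≰n (≤-trans 2≤π (≤-trans (paths (≢-outside w∉B g∈B ∘ sym))
            (≤-trans (#-mono (out? g ∩? in? w) (B? ∩? (out? g ∩? in? w)) (λ { (gy , yw) →
              B-inside (λ y∉B → ⟶-asym gy (w-below y∉B g∈B wg)) , gy , yw })) few))))

        -- By `w-below` a path vertex dominated by `w` is dominated by `v` too, so it cannot be the
        -- midpoint of a 2-path from `w` to `v`.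
        N-large : 2 * π + 1 ≤ # N?
        N-large = subst (2 * π + 1 ≤_) (+-identityʳ _)
          (in-degrees⇒large N? 0 π ∃N λ { v (v∉B , wv) →
            ≤-trans (paths (⟶⇒≢ wv)) (#-mono (out? w ∩? in? v) (N? ∩? in? v)
              λ { (wy , yv) → ((λ y∈B → ⟶-asym yv (w-below v∉B y∈B wy)) , wy) , yv }) })

        N-small : # N? ≤ i + 2
        N-small = ≤-trans (#-mono N? Mid? λ { (y∉B , _) → y∉B , f-loses y∉B , l-wins y∉B }) mid≤

        clash : 2 * π + 1 ≤ i + 2 → i + 3 ≤ 2 * π → ⊥
        clash h₁ h₂ = exceeds⇒⊥ 1 (h₁ ⊕ h₂) (solve (i ∷ π ∷ []))

        absurd : ⊥
        absurd = clash (≤-trans N-large N-small) i+3≤2π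

      absurd : ⊥
      absurd with any? Low? | any? High?
      ... | yes ∃low | yes ∃high = combine (# B?) (# (∁? B?)) (# Low?) (# High?) (# Mid?)
          (# (B? ∩? out? f)) (# (B? ∩? out? l)) (# (B? ∩? in? l))
          out-f (balance m∉B mf′ l′m) in-l (#-out+in≤ B? l∈B)
          (dominated-bound b Low? B? ∃low λ { u∈B (z∉B , fz) → f-first z∉B u∈B fz })
          (dominated-bound (op-bounds b) High? B? ∃high λ { u∈B (z∉B , zl) → l-last z∉B u∈B zl })
          n≤B+∁B covered mid≤ gap
      ... | yes (z , z∉B , fz) | no ¬high =
          OneSided.no-low b B? f∈B l∈B f-first l-wins
            (≤-trans (#-mono (∁? B? ∩? in? f) Mid? λ { (y∉B , yf) → y∉B , yf , l-wins y∉B }) mid≤)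
            z∉B fz
        where
        l-wins : ∀ {z} → ¬ B z → l ⟶ z
        l-wins z∉B = ¬⟶ʳ z∉B l∈B λ zl → ¬high (_ , z∉B , zl)
      -- The dual case: the tournament is reversed and the ends exchange roles.
      ... | no ¬low | yes (z , z∉B , zl) =
          OneSided.no-low (op-bounds b) B? l∈B f∈B l-last f-loses
            (≤-trans (#-mono (∁? B? ∩? out? l) Mid? λ { (y∉B , ly) → y∉B , f-loses y∉B , ly }) mid≤)
            z∉B zl
        where
        f-loses : ∀ {z} → ¬ B z → z ⟶ f
        f-loses z∉B = ¬⟶ˡ z∉B f∈B λ fz → ¬low (_ , z∉B , fz)
      ... | no ¬low | no ¬high
        with w , w∉B , least ← minimiser (∁? B?) (λ z → # (B? ∩? out? z)) (m , m∉B) = AllMiddle.absurd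
          (λ z∉B → ¬⟶ˡ z∉B f∈B λ fz → ¬low (_ , z∉B , fz))
          (λ z∉B → ¬⟶ʳ z∉B l∈B λ zl → ¬high (_ , z∉B , zl)) w∉B least

    no-outside : ∀ {z} → B z
    no-outside {z} with any? (∁? B? ∩? (in? f′ ∩? out? l′))
    ... | yes (m , m∉B , mf′ , l′m) = ⊥-elim (Middle.absurd m∉B mf′ l′m)
    ... | no ¬M = B-inside (NoMiddle.absurd λ z∉B zf′ l′z → ¬M (_ , z∉B , zf′ , l′z))

-- Lists without repetition, and bounded search

open import Data.List.Relation.Unary.All as All using (_∷_)
open import Data.List.Relation.Unary.AllPairs as AllPairs using ([]; _∷_)
open import Data.List.Relation.Unary.Linked as Linked using (Linked; []; [-]; _∷_)

module _ {n : ℕ} where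
  open DecMembership (_≟ᶠ_ {n}) public using (_∈?_)

#-filter : {Q : Pred (Fin n) 0ℓ} (Q? : Decidable Q) → ∀ {xs} → Unique xs →
           # ((_∈? xs) ∩? Q?) ≡ length (filter Q? xs)
#-filter Q? {[]} [] = #-empty ((_∈? []) ∩? Q?) λ { _ (() , _) }
#-filter {Q = Q} Q? {x ∷ xs} (x∉xs ∷ uniq) with Q? x
... | yes qx = trans (≤-antisym
    (≤-trans (#-∪ ((_∈? (x ∷ xs)) ∩? Q?) (_≟ᶠ x) ((_∈? xs) ∩? Q?)
      λ { (here v≡x , _) → inj₁ v≡x ; (there v∈xs , qv) → inj₂ (v∈xs , qv) })
      (+-monoˡ-≤ _ (≤-reflexive (#-≡ x))))
    (≤-trans (+-monoˡ-≤ _ (≤-reflexive (sym (#-≡ x))))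
      (#-disjoint (_≟ᶠ x) ((_∈? xs) ∩? Q?) ((_∈? (x ∷ xs)) ∩? Q?)
        (λ { refl → here refl , qx }) (λ { (v∈xs , qv) → there v∈xs , qv })
        λ { refl (x∈xs , _) → All.lookup x∉xs x∈xs refl })))
    (cong suc (#-filter Q? uniq))
... | no ¬qx = trans (≤-antisym
    (#-mono ((_∈? (x ∷ xs)) ∩? Q?) ((_∈? xs) ∩? Q?)
      λ { (here refl , qx) → contradiction qx ¬qx ; (there v∈xs , qv) → v∈xs , qv })
    (#-mono ((_∈? xs) ∩? Q?) ((_∈? (x ∷ xs)) ∩? Q?) λ { (v∈xs , qv) → there v∈xs , qv }))
    (#-filter Q? uniq)

unique⇒#≡length : ∀ {xs : List (Fin n)} → Unique xs → # ((_∈? xs) ∩? U?) ≡ length xs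
unique⇒#≡length {xs = xs} uniq =
  trans (#-filter U? uniq) (cong length (filter-all U? (All.universal (λ _ → tt) xs)))

unique⇒length≤n : ∀ {xs : List (Fin n)} → Unique xs → length xs ≤ n
unique⇒length≤n {n} {xs} uniq = begin
  length xs             ≡⟨ unique⇒#≡length uniq ⟨
  # ((_∈? xs) ∩? U?)    ≤⟨ #-mono ((_∈? xs) ∩? U?) U? (λ _ → tt) ⟩
  # (U? {A = Fin n})    ≡⟨ #-U ⟩
  n ∎
  where open ≤-Reasoning

covering⇒n≤length : ∀ {xs : List (Fin n)} → Unique xs → (∀ v → v ∈ xs) → n ≤ length xs
covering⇒n≤length {n} {xs} uniq covers = begin
  n                     ≡⟨ #-U ⟨
  # (U? {A = Fin n})    ≤⟨ #-mono U? ((_∈? xs) ∩? U?) (λ {v} _ → covers v , tt) ⟩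
  # ((_∈? xs) ∩? U?)    ≡⟨ unique⇒#≡length uniq ⟩
  length xs ∎
  where open ≤-Reasoning

∃-list? : ∀ k {Q : List (Fin n) → Set} → (∀ xs → Dec (Q xs)) →
          Dec (∃ λ xs → length xs ≤ k × Q xs)
∃-list? zero Q? with Q? []
... | yes q = yes ([] , z≤n , q)
... | no ¬q = no λ { ([] , _ , q) → ¬q q }
∃-list? (suc k) Q? with Q? [] | any? (λ x → ∃-list? k (Q? ∘ (x ∷_)))
... | yes q | _ = yes ([] , z≤n , q)
... | no _  | yes (x , xs , len , q) = yes (x ∷ xs , s≤s len , q)
... | no ¬q | no ¬∃ = no λ { ([] , _ , q) → ¬q q ; (x ∷ xs , s≤s len , q) → ¬∃ (x , xs , len , q) }

unique-resp-↭ : ∀ {xs ys : List (Fin n)} → xs ↭ ys → Unique xs → Unique ys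
unique-resp-↭ {n} p = Permutationₛ.Unique-resp-↭ (setoid (Fin n)) (↭⇒↭ₛ p)

unique-last : ∀ {xs} {e : Fin n} → Unique (xs ++ [ e ]) → ∀ {u} → u ∈ xs → u ≢ e
unique-last {xs = _ ∷ xs} (x∉ ∷ _) (here refl) = All.lookup x∉ (∈-++⁺ʳ xs (here refl))
unique-last {xs = _ ∷ _} (_ ∷ uniq) (there u∈xs) = unique-last uniq u∈xs

unique-init : ∀ {xs} {e : Fin n} → Unique (xs ++ [ e ]) → Unique xs
unique-init {xs = []}     _            = []
unique-init {xs = x ∷ xs} (x∉ ∷ uniq) = All.tabulate (All.lookup x∉ ∘ ∈-++⁺ˡ) ∷ unique-init uniq

-- Walks, cuts and the rearrangement of paths

module Walks {n} (T : Tournament n) where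
  open Arrows T

  data Walk : Fin n → List (Fin n) → Fin n → Set where
    stop : ∀ {a} → Walk a [ a ] a
    _∷_  : ∀ {a b xs c} → a ⟶ b → Walk b xs c → Walk a (a ∷ xs) c

  private variable
    a b c d g h s e u v z : Fin n
    xs ys : List (Fin n)

  _⟨_⟩_ : Walk a xs b → b ⟶ c → Walk c ys d → Walk a (xs ++ ys) d
  stop     ⟨ q ⟩ w = q ∷ w
  (p ∷ w′) ⟨ q ⟩ w = p ∷ (w′ ⟨ q ⟩ w)

  infixr 5 _⟨_⟩_

  fromArcs : ∀ x xs → Arcs T (x ∷ xs) → ∃ λ e → Walk x (x ∷ xs) e
  fromArcs x []       _         = x , stop
  fromArcs x (y ∷ xs) (xy , ps) with e , w ← fromArcs y xs ps = e , xy ∷ w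

  toArcs : Walk a xs b → Arcs T xs
  toArcs stop             = tt
  toArcs (p ∷ stop)       = p , tt
  toArcs (p ∷ w@(_ ∷ _))  = p , toArcs w

  first∈ : Walk a xs b → a ∈ xs
  first∈ stop    = here refl
  first∈ (_ ∷ _) = here refl

  last∈ : Walk a xs b → b ∈ xs
  last∈ stop    = here refl
  last∈ (_ ∷ w) = there (last∈ w)

  walk-head : Walk a xs b → head xs ≡ just a
  walk-head stop    = refl
  walk-head (_ ∷ _) = refl

  walk-last : Walk a xs b → last xs ≡ just b
  walk-last stop            = refl
  walk-last (_ ∷ stop)      = refl
  walk-last (_ ∷ w@(_ ∷ _)) = walk-last w

  walk-cons : Walk a xs b → ∃ λ ys → xs ≡ a ∷ ys
  walk-cons stop    = [] , refl
  walk-cons (_ ∷ w) = _ , refl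

  walk-snoc : Walk a xs b → ∃ λ ys → xs ≡ ys ++ [ b ]
  walk-snoc stop = [] , refl
  walk-snoc {a} (_ ∷ w) with ys , refl ← walk-snoc w = a ∷ ys , refl

  unsnoc : Walk a xs b → (xs ≡ [ a ] × a ≡ b) ⊎
           ∃ λ c → ∃ λ ys → Walk a ys c × c ⟶ b × xs ≡ ys ++ [ b ]
  unsnoc stop = inj₁ (refl , refl)
  unsnoc (p ∷ w) with unsnoc w
  ... | inj₁ (refl , refl) = inj₂ (_ , _ , stop , p , refl)
  ... | inj₂ (_ , _ , w′ , q , refl) = inj₂ (_ , _ , p ∷ w′ , q , refl)

  record Cut (s : Fin n) (xs : List (Fin n)) (e g h : Fin n) : Set where
    constructor cut
    field
      {left right} : List (Fin n)
      walkˡ : Walk s left g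
      arc-⟶ : g ⟶ h
      walkʳ : Walk h right e
      xs≡   : xs ≡ left ++ right

  push : s ⟶ a → Cut a xs e g h → Cut s (s ∷ xs) e g h
  push {s = s} p (cut w q w′ eq) = cut (p ∷ w) q w′ (cong (s ∷_) eq)

  cuts⇒linked : {R : Fin n → Fin n → Set} → Walk s xs e →
                (∀ {g h} → Cut s xs e g h → R g h) → Linked R xs
  cuts⇒linked stop    r = [-]
  cuts⇒linked (p ∷ w) r with _ , refl ← walk-cons w =
    r (cut stop p w refl) ∷ cuts⇒linked w (r ∘ push p)

  cut-after : Walk s xs e → u ∈ xs → u ≢ e → ∃ λ y → Cut s xs e u y
  cut-after stop    (here refl) u≢e = contradiction refl u≢e
  cut-after (p ∷ w) (here refl) u≢e = _ , cut stop p w refl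
  cut-after (p ∷ w) (there u∈)  u≢e with y , k ← cut-after w u∈ u≢e = y , push p k

  cut-before : Walk s xs e → v ∈ xs → v ≢ s → ∃ λ c → Cut s xs e c v
  cut-before stop    (here refl) v≢s = contradiction refl v≢s
  cut-before (p ∷ w) (here refl) v≢s = contradiction refl v≢s
  cut-before {v = v} (_∷_ {b = b} p w) (there v∈)  v≢s with v ≟ᶠ b
  ... | yes refl = _ , cut stop p w refl
  ... | no  v≢b with c , k ← cut-before w v∈ v≢b = c , push p k

  -- Along the walk the arcs to `z` change direction from the first vertex to the last, so they
  -- change across some arc.
  turning-cut : Walk s xs e → z ∉ xs → z ⟶ s → e ⟶ z →
                ∃ λ g → ∃ λ h → Cut s xs e g h × z ⟶ g × h ⟶ z
  turning-cut stop z∉ zs ez = contradiction ez (⟶-asym zs)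
  turning-cut {z = z} (_∷_ {b = b} p w) z∉ zs ez with b ⟶? z
  ... | yes bz = _ , _ , cut stop p w refl , zs , bz
  ... | no ¬bz
    with g , h , k , zg , hz ← turning-cut w (z∉ ∘ there)
           (⟶-total (λ { refl → z∉ (there (first∈ w)) }) ¬bz) ez = g , h , push p k , zg , hz

  NoInsert : Fin n → List (Fin n) → Set
  NoInsert z = Linked (λ a c → ¬ (a ⟶ z × z ⟶ c))

  -- If `a` dominates `z`, its successor must do so as well, since otherwise `z` fits between them.
  upward : NoInsert z (a ∷ xs) → z ∉ a ∷ xs → a ⟶ z → v ∈ a ∷ xs → v ⟶ z
  upward link       z∉ az (here refl) = az
  upward (¬azb ∷ link) z∉ az (there v∈) =
    upward link (z∉ ∘ there)
      (⟶-total (λ { refl → z∉ (there (here refl)) }) (λ zb → ¬azb (az , zb))) v∈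

  upward-from : ∀ xs → NoInsert z (xs ++ h ∷ ys) → z ∉ xs ++ h ∷ ys → h ⟶ z → v ∈ h ∷ ys → v ⟶ z
  upward-from []       link z∉ = upward link z∉
  upward-from (x ∷ xs) link z∉ = upward-from xs (Linked.tail link) (z∉ ∘ there)

  upward-to : ∀ xs → NoInsert z (xs ++ e ∷ ys) → z ∉ xs ++ e ∷ ys → u ∈ xs ++ [ e ] → u ⟶ z → e ⟶ z
  upward-to []       link z∉ (here refl) uz = uz
  upward-to (x ∷ xs) link z∉ (here refl) uz = upward link z∉ uz (there (∈-++⁺ʳ xs (here refl)))
  upward-to (x ∷ xs) link z∉ (there u∈)  uz = upward-to xs (Linked.tail link) (z∉ ∘ there) u∈ uz

  left-below : (k : Cut s xs e g h) → NoInsert z xs → z ∉ xs → z ⟶ g → u ∈ Cut.left k → z ⟶ u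
  left-below {g = g} {z = z} (cut {right = right} w₁ _ _ refl) link z∉ zg u∈
    with ys , refl ← walk-snoc w₁ =
    ⟶-total (λ { refl → z∉ (∈-++⁺ˡ u∈) }) λ uz → ⟶-asym zg
      (upward-to ys (subst (NoInsert z) eq link) (subst (z ∉_) eq z∉) u∈ uz)
    where eq = ++-assoc ys [ g ] right

  right-above : (k : Cut s xs e g h) → NoInsert z xs → z ∉ xs → h ⟶ z → u ∈ Cut.right k → u ⟶ z
  right-above (cut {left} _ _ w₂ refl) link z∉ hz u∈ with _ , refl ← walk-cons w₂ =
    upward-from left link z∉ hz u∈

  _≼[_]_ : Fin n → List (Fin n) → Fin n → Set
  u ≼[ xs ] v = ∀ {z} → NoInsert z xs → z ∉ xs → u ⟶ z → v ⟶ z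

  -- The vertex that comes later on the list is the larger one, by `upward`.
  ≼-total : u ∈ xs → v ∈ xs → u ≼[ xs ] v ⊎ v ≼[ xs ] u
  ≼-total (here refl) v∈          = inj₁ λ link z∉ uz → upward link z∉ uz v∈
  ≼-total u∈          (here refl) = inj₂ λ link z∉ vz → upward link z∉ vz u∈
  ≼-total (there u∈)  (there v∈) with ≼-total u∈ v∈
  ... | inj₁ u≼v = inj₁ λ link z∉ → u≼v (Linked.tail link) (z∉ ∘ there)
  ... | inj₂ v≼u = inj₂ λ link z∉ → v≼u (Linked.tail link) (z∉ ∘ there)

  -- Each out-neighbour of `u` in `xs` is matched with its predecessor, which cannot dominate `v`
  -- and is therefore dominated by it.
  shifted-filter : ∀ xs → Linked (λ g h → ¬ (u ⟶ h × g ⟶ v)) (a ∷ xs) → v ∉ a ∷ xs →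
                   length (filter (out? u) xs) ≤ length (filter (out? v) (a ∷ xs))
  shifted-filter []       link v∉ = z≤n
  shifted-filter {u = u} {v = v} {a = a} (b ∷ xs) (¬cross ∷ link) v∉
    with u ⟶? b | v ⟶? a | shifted-filter xs link (v∉ ∘ there)
  ... | no _   | no _   | ih = ih
  ... | no _   | yes _  | ih = m≤n⇒m≤1+n ih
  ... | yes _  | yes _  | ih = s≤s ih
  ... | yes ub | no ¬va | ih = contradiction (ub , ⟶-total (λ { refl → v∉ (here refl) }) ¬va) ¬cross

  extend : Walk s xs e → Unique xs → z ∉ xs → Walk s ys e → ys ↭ z ∷ xs → Extendable T xs
  extend {xs = xs} {z = z} {ys = ys} w uniq z∉ w′ p = z , z∉ , ys ,
    (unique-resp-↭ (↭-sym p) (All.tabulate (λ { x∈ refl → z∉ x∈ }) ∷ uniq) , toArcs w′) ,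
    trans (walk-head w′) (sym (walk-head w)) , trans (walk-last w′) (sym (walk-last w)) ,
    λ x → mk⇔ (λ x∈ → from (∈-resp-↭ p x∈)) (λ x∈ → ∈-resp-↭ (↭-sym p) (to x∈))
    where
    from : ∀ {x} → x ∈ z ∷ xs → x ≡ z ⊎ x ∈ xs
    from (here x≡z) = inj₁ x≡z
    from (there x∈) = inj₂ x∈
    to : ∀ {x} → x ≡ z ⊎ x ∈ xs → x ∈ z ∷ xs
    to (inj₁ x≡z) = here x≡z
    to (inj₂ x∈)  = there x∈

  module _ (w : Walk s xs e) (uniq : Unique xs) (z∉ : z ∉ xs) where

    insert : Cut s xs e g h → g ⟶ z → z ⟶ h → Extendable T xs
    insert (cut {left} {right} w₁ _ w₂ refl) gz zh =
      extend w uniq z∉ (w₁ ⟨ gz ⟩ zh ∷ w₂) (shift z left right)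

    -- The blocks of P = X₁ X₂ Y₁ Y₂ are rearranged into X₁ Y₁ z X₂ Y₂.
    rotate : (k : Cut s xs e g h) → (let open Cut k) →
      Cut s left g a b → Cut h right e c d →
      a ⟶ h → c ⟶ z → z ⟶ b → g ⟶ d → Extendable T xs
    rotate (cut _ _ _ refl) (cut {X₁} {X₂} x₁ _ x₂ refl) (cut {Y₁} {Y₂} y₁ _ y₂ refl) ah cz zb gd =
      extend w uniq z∉ (x₁ ⟨ ah ⟩ y₁ ⟨ cz ⟩ zb ∷ (x₂ ⟨ gd ⟩ y₂)) perm
      where
      open PermutationReasoning
      perm : X₁ ++ Y₁ ++ _ ∷ X₂ ++ Y₂ ↭ _ ∷ (X₁ ++ X₂) ++ Y₁ ++ Y₂
      perm = begin
        X₁ ++ Y₁ ++ _ ∷ X₂ ++ Y₂     ↭⟨ ++⁺ˡ X₁ (shift _ Y₁ (X₂ ++ Y₂)) ⟩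
        X₁ ++ _ ∷ Y₁ ++ X₂ ++ Y₂     ↭⟨ shift _ X₁ _ ⟩
        _ ∷ X₁ ++ Y₁ ++ X₂ ++ Y₂     ≡⟨ cong (λ r → _ ∷ X₁ ++ r) (++-assoc Y₁ X₂ Y₂) ⟨
        _ ∷ X₁ ++ (Y₁ ++ X₂) ++ Y₂   ↭⟨ ++⁺ˡ (_ ∷ X₁) (++⁺ʳ Y₂ (++-comm Y₁ X₂)) ⟩
        _ ∷ X₁ ++ (X₂ ++ Y₁) ++ Y₂   ≡⟨ cong (λ r → _ ∷ X₁ ++ r) (++-assoc X₂ Y₁ Y₂) ⟩
        _ ∷ X₁ ++ X₂ ++ Y₁ ++ Y₂     ≡⟨ cong (_ ∷_) (++-assoc X₁ X₂ (Y₁ ++ Y₂)) ⟨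
        _ ∷ (X₁ ++ X₂) ++ Y₁ ++ Y₂   ∎

-- The structure of a nonextendable path

module Nonextendable {n} {T : Tournament n} {π i : ℕ} (b : Bounds T π i) where
  open Arrows T
  open Walks T

  module _
    -- The interior `Q` is nonempty, but `f′` and `l′` coincide when the path has three vertices.
    {f f′ l′ l : Fin n} {Q : List (Fin n)}
    (f⟶f′ : f ⟶ f′) (interior : Walk f′ Q l′) (l′⟶l : l′ ⟶ l)
    (uniq : Unique (f ∷ Q ++ [ l ])) (¬ext : ¬ Extendable T (f ∷ Q ++ [ l ]))
    where

    P : List (Fin n)
    P = f ∷ Q ++ [ l ]

    P-walk : Walk f P l
    P-walk = f⟶f′ ∷ (interior ⟨ l′⟶l ⟩ stop)

    uniq′ : Unique (Q ++ [ l ])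
    uniq′ = AllPairs.tail uniq

    no-insert : ∀ {z} → z ∉ P → NoInsert z P
    no-insert z∉P = cuts⇒linked P-walk λ k (gz , zh) → ¬ext (insert P-walk uniq z∉P k gz zh)

    f′-first : ∀ {z u} → z ∉ P → u ∈ P → u ≢ f → f′ ⟶ z → u ⟶ z
    f′-first z∉P (here refl) u≢f f′z = contradiction refl u≢f
    f′-first z∉P (there u∈) u≢f f′z with _ , refl ← walk-cons interior =
      upward (Linked.tail (no-insert z∉P)) (z∉P ∘ there) f′z u∈

    outside-total : ∀ {z u} → z ∉ P → u ∈ P → ¬ u ⟶ z → z ⟶ u
    outside-total z∉P u∈P = ⟶-total λ { refl → z∉P u∈P }

    l-last : ∀ {z u} → z ∉ P → u ∈ P → z ⟶ l → z ⟶ u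
    l-last z∉P u∈P zl = outside-total z∉P u∈P λ uz →
      ⟶-asym zl (upward-to (f ∷ Q) (no-insert z∉P) z∉P u∈P uz)

    l′-last : ∀ {z u} → z ∉ P → u ∈ P → u ≢ l → z ⟶ l′ → z ⟶ u
    l′-last {z} z∉P u∈P u≢l zl′ with ys , refl ← walk-snoc interior =
      outside-total z∉P u∈P λ uz → ⟶-asym zl′
        (upward-to (f ∷ ys) (subst (NoInsert z) eq (no-insert z∉P)) (subst (z ∉_) eq z∉P) u∈ uz)
      where
      eq : P ≡ (f ∷ ys) ++ l′ ∷ [ l ]
      eq = cong (f ∷_) (++-assoc ys [ l′ ] [ l ])
      u∈ : _ ∈ f ∷ ys ++ [ l′ ]
      u∈ with ∈-++⁻ (f ∷ ys ++ [ l′ ]) u∈P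
      ... | inj₁ u∈         = u∈
      ... | inj₂ (here u≡l) = contradiction u≡l u≢l

    -- Otherwise f, h, ..., l′, z, f′, ..., g, l extends `P`: a rotation whose outer blocks are the
    -- single vertices `f` and `l`.
    no-cross : ∀ {z} → z ∉ P → z ⟶ f′ → l′ ⟶ z → Linked (λ g h → ¬ (f ⟶ h × g ⟶ l)) Q
    no-cross z∉P zf′ l′z = cuts⇒linked interior λ { (cut {left} {right} w₁ p w₂ eq) (fh , gl) →
      ¬ext (rotate P-walk uniq z∉P
        (cut (f⟶f′ ∷ w₁) p (w₂ ⟨ l′⟶l ⟩ stop)
          (cong (f ∷_) (trans (cong (_++ [ l ]) eq) (++-assoc left right [ l ]))))
        (cut stop f⟶f′ w₁ refl) (cut w₂ l′⟶l stop refl) fh l′z zf′ gl) }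

    -- Out-neighbours of `f` in the interior beyond `f′` are shifted to out-neighbours of `l`; the
    -- summand 2 pays for `f′` and possibly `l`.
    balance : ∀ {z} → z ∉ P → z ⟶ f′ → l′ ⟶ z →
              # ((_∈? P) ∩? out? f) ≤ # ((_∈? P) ∩? out? l) + 2
    balance z∉P zf′ l′z with Q′ , refl ← walk-cons interior = begin
      # ((_∈? P) ∩? out? f)
        ≤⟨ #-∪ ((_∈? P) ∩? out? f) (_≟ᶠ f′) ((_∈? (l ∷ Q′)) ∩? out? f) split₁ ⟩
      # (_≟ᶠ f′) + # ((_∈? (l ∷ Q′)) ∩? out? f)
        ≤⟨ +-mono-≤ (≤-reflexive (#-≡ f′))
            (#-∪ ((_∈? (l ∷ Q′)) ∩? out? f) (_≟ᶠ l) ((_∈? Q′) ∩? out? f) split₂) ⟩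
      1 + (# (_≟ᶠ l) + # ((_∈? Q′) ∩? out? f))
        ≡⟨ cong₂ (λ x y → 1 + (x + y)) (#-≡ l) (#-filter (out? f) (AllPairs.tail uniqQ)) ⟩
      2 + length (filter (out? f) Q′)
        ≤⟨ +-monoʳ-≤ 2 (shifted-filter Q′ (no-cross z∉P zf′ l′z) λ l∈Q → unique-last uniq′ l∈Q refl) ⟩
      2 + length (filter (out? l) (f′ ∷ Q′))
        ≡⟨ cong (2 +_) (#-filter (out? l) uniqQ) ⟨
      2 + # ((_∈? (f′ ∷ Q′)) ∩? out? l)
        ≤⟨ +-monoʳ-≤ 2 (#-mono ((_∈? (f′ ∷ Q′)) ∩? out? l) ((_∈? P) ∩? out? l)
            λ { (y∈ , ly) → there (∈-++⁺ˡ y∈) , ly }) ⟩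
      2 + # ((_∈? P) ∩? out? l)
        ≡⟨ +-comm 2 _ ⟩
      # ((_∈? P) ∩? out? l) + 2 ∎
      where
      open ≤-Reasoning
      uniqQ : Unique (f′ ∷ Q′)
      uniqQ = unique-init uniq′
      split₁ : ∀ {y} → y ∈ P × f ⟶ y → y ≡ f′ ⊎ (y ∈ l ∷ Q′ × f ⟶ y)
      split₁ (here refl , fy)         = contradiction refl (⟶⇒≢ fy)
      split₁ (there (here y≡f′) , fy) = inj₁ y≡f′
      split₁ (there (there y∈) , fy) with ∈-++⁻ Q′ y∈
      ... | inj₁ y∈Q′       = inj₂ (there y∈Q′ , fy)
      ... | inj₂ (here y≡l) = inj₂ (here y≡l , fy)
      split₂ : ∀ {y} → y ∈ l ∷ Q′ × f ⟶ y → y ≡ l ⊎ (y ∈ Q′ × f ⟶ y)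
      split₂ (here y≡l , _)   = inj₁ y≡l
      split₂ (there y∈Q′ , fy) = inj₂ (y∈Q′ , fy)

    turn : ∀ {z} → z ∉ P → z ⟶ f → l ⟶ z → ∃ λ g → ∃ λ h → z ⟶ g × h ⟶ z × g ∈ P × h ∈ P ×
           (# ((_∈? P) ∩? (out? z ∩? in? h)) ≤ 1 ⊎ # ((_∈? P) ∩? (out? g ∩? in? z)) ≤ 1)
    turn {z} z∉P zf lz with turning-cut P-walk z∉P zf lz
    ... | g , h , k , zg , hz = g , h , zg , hz , left⊆P (last∈ walkˡ) , right⊆P (first∈ walkʳ) , few
      where
      open Cut k
      left⊆P : ∀ {u} → u ∈ left → u ∈ P
      left⊆P u∈ = subst (_ ∈_) (sym xs≡) (∈-++⁺ˡ u∈)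
      right⊆P : ∀ {u} → u ∈ right → u ∈ P
      right⊆P u∈ = subst (_ ∈_) (sym xs≡) (∈-++⁺ʳ left u∈)

      below : ∀ {u} → u ∈ left → z ⟶ u
      below = left-below k (no-insert z∉P) z∉P zg
      above : ∀ {u} → u ∈ right → u ⟶ z
      above = right-above k (no-insert z∉P) z∉P hz

      in-left : ∀ {u} → u ∈ P → z ⟶ u → u ∈ left
      in-left u∈P zu with ∈-++⁻ left (subst (_ ∈_) xs≡ u∈P)
      ... | inj₁ u∈ = u∈
      ... | inj₂ u∈ = contradiction (above u∈) (⟶-asym zu)
      in-right : ∀ {u} → u ∈ P → u ⟶ z → u ∈ right
      in-right u∈P uz with ∈-++⁻ left (subst (_ ∈_) xs≡ u∈P)
      ... | inj₁ u∈ = contradiction (below u∈) (⟶-asym uz)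
      ... | inj₂ u∈ = u∈

      -- With `y` the successor of `u` and `c` the predecessor of `v`, the path ..., u, h, ..., c,
      -- z, y, ..., g, v, ... would extend `P`.
      rotation : ∀ {u v} → u ∈ P → z ⟶ u → u ⟶ h → u ≢ g → v ∈ P → g ⟶ v → v ⟶ z → v ≢ h → ⊥
      rotation u∈P zu uh u≢g v∈P gv vz v≢h
        with y , k₁ ← cut-after walkˡ (in-left u∈P zu) u≢g
        with c , k₂ ← cut-before walkʳ (in-right v∈P vz) v≢h
        = ¬ext (rotate P-walk uniq z∉P k k₁ k₂ uh
            (above (subst (c ∈_) (sym (Cut.xs≡ k₂)) (∈-++⁺ˡ (last∈ (Cut.walkˡ k₂)))))
            (below (subst (y ∈_) (sym (Cut.xs≡ k₁)) (∈-++⁺ʳ (Cut.left k₁) (first∈ (Cut.walkʳ k₁)))))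
            gv)

      Into-h?  = (_∈? P) ∩? (out? z ∩? in? h)
      From-g?  = (_∈? P) ∩? (out? g ∩? in? z)

      -- By `rotation`, `g` is the only possible element of the first set or `h` the only one of the
      -- second.
      few : # Into-h? ≤ 1 ⊎ # From-g? ≤ 1
      few with any? (Into-h? ∩? ∁? (_≟ᶠ g)) | any? (From-g? ∩? ∁? (_≟ᶠ h))
      ... | no ¬u | _     = inj₁ (#-subsingleton Into-h? g λ u p →
                              decidable-stable (u ≟ᶠ g) λ u≢g → ¬u (u , p , u≢g))
      ... | yes _ | no ¬v = inj₂ (#-subsingleton From-g? h λ v p →
                              decidable-stable (v ≟ᶠ h) λ v≢h → ¬v (v , p , v≢h))
      ... | yes (u , (u∈P , zu , uh) , u≢g) | yes (v , (v∈P , gv , vz) , v≢h) =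
        ⊥-elim (rotation u∈P zu uh u≢g v∈P gv vz v≢h)

    ordered : ∀ {u v} → u ∈ P → v ∈ P →
      (∀ {z} → z ∉ P → u ⟶ z → v ⟶ z) ⊎ (∀ {z} → z ∉ P → v ⟶ z → u ⟶ z)
    ordered u∈P v∈P with ≼-total u∈P v∈P
    ... | inj₁ u≼v = inj₁ λ z∉P → u≼v (no-insert z∉P) z∉P
    ... | inj₂ v≼u = inj₂ λ z∉P → v≼u (no-insert z∉P) z∉P

    spanning : ∀ v → v ∈ P
    spanning v = Core.no-outside b (_∈? P) {f} {f′} {l′} {l}
      (here refl) (there (∈-++⁺ˡ (first∈ interior))) (there (∈-++⁺ˡ (last∈ interior)))
      (there (∈-++⁺ʳ Q (here refl))) f⟶f′ l′⟶l
      (All.lookup (AllPairs.head uniq) (∈-++⁺ʳ Q (here refl)))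
      (unique-last uniq′ (first∈ interior))
      (λ z∉P u∈P fz → upward (no-insert z∉P) z∉P fz u∈P)
      f′-first l-last l′-last
      ordered balance turn

-- Deciding extendability, and the passage to arbitrary paths

module _ (T : Tournament n) where
  open Arrows T

  arcs? : ∀ xs → Dec (Arcs T xs)
  arcs? []           = yes tt
  arcs? (x ∷ [])     = yes tt
  arcs? (x ∷ y ∷ xs) = x ⟶? y ×-dec arcs? (y ∷ xs)

  -- An extension repeats no vertex, so it has at most n entries and the search is finite.
  -- Decidability lets the proof by contradiction produce an actual extension.
  extendable? : ∀ P → Dec (Extendable T P)
  extendable? P = any? λ w → ¬? (w ∈? P) ×-dec
    map′ (λ (P′ , _ , q) → P′ , q) (λ { (P′ , q@((uniq , _) , _)) → P′ , unique⇒length≤n uniq , q })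
      (∃-list? n λ P′ → (unique? _≟ᶠ_ P′ ×-dec arcs? P′) ×-dec
        Maybe.≡-dec _≟ᶠ_ (head P′) (head P) ×-dec Maybe.≡-dec _≟ᶠ_ (last P′) (last P) ×-dec
        all? λ x → map′ (λ (to , from) → mk⇔ to from) (λ e → Equivalence.to e , Equivalence.from e)
          (((x ∈? P′) →-dec ((x ≟ᶠ w) ⊎-dec (x ∈? P))) ×-dec
           (((x ≟ᶠ w) ⊎-dec (x ∈? P)) →-dec (x ∈? P′))))

  module _ {π i : ℕ} (b : Bounds T π i) where
    open Walks T

    extend-walk : ∀ {f f′ l xs} → f ⟶ f′ → Walk f′ xs l → Unique (f ∷ xs) → length (f ∷ xs) < n →
                  Extendable T (f ∷ xs)
    extend-walk p w uniq len<n with unsnoc w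
    -- A path with a single arc has no interior; the midpoint of any 2-path between its ends can be
    -- inserted.
    ... | inj₁ (refl , refl) with z , fz , zf′ ← Degrees.∃-path b (⟶⇒≢ p) =
      insert (p ∷ stop) uniq
        (λ { (here refl) → ⟶⇒≢ fz refl ; (there (here refl)) → ⟶⇒≢ zf′ refl })
        (cut stop p stop refl) fz zf′
    extend-walk p w uniq len<n | inj₂ (_ , _ , interior , q , refl) =
      decidable-stable (extendable? _) λ ¬ext → <⇒≱ len<n
        (covering⇒n≤length uniq (Nonextendable.spanning b p interior q uniq ¬ext))

    extend-path : ∀ P → IsPath T P → 2 ≤ length P → length P < n → Extendable T P
    extend-path (x ∷ [])     _                 (s≤s ())
    extend-path (f ∷ f′ ∷ R) (uniq , p , arcs) _ len<n =
      extend-walk p (proj₂ (fromArcs f′ R arcs)) uniq len<n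

  opaque
    unfolding #_

    countB-allFin : ∀ (q : Fin n → Bool) → countB q (allFin n) ≡ # (λ v → q v Bool.≟ true)
    countB-allFin q = go q id
      where
      go : ∀ {m} {A : Set} (q : A → Bool) (g : Fin m → A) →
           countB q (tabulate g) ≡ # (λ v → q (g v) Bool.≟ true)
      go {zero}  q g = refl
      go {suc m} q g with q (g zero) | go q (g ∘ suc)
      ... | true  | ih = cong suc ih
      ... | false | ih = ih

-- From the minimum and maximum in the definitions to `Bounds`

foldr-⊓-≤ : ∀ {x xs y} → y ∈ x ∷ xs → foldr _⊓_ x xs ≤ y
foldr-⊓-≤ {xs = []}     (here refl)         = ≤-refl
foldr-⊓-≤ {xs = z ∷ xs} (here refl)         = ≤-trans (m⊓n≤n z _) (foldr-⊓-≤ {xs = xs} (here refl))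
foldr-⊓-≤ {xs = z ∷ xs} (there (here refl)) = m⊓n≤m z _
foldr-⊓-≤ {xs = z ∷ xs} (there (there y∈))  = ≤-trans (m⊓n≤n z _) (foldr-⊓-≤ {xs = xs} (there y∈))

≤-foldr-⊔ : ∀ {xs y} → y ∈ xs → y ≤ foldr _⊔_ 0 xs
≤-foldr-⊔ (here refl) = m≤m⊔n _ _
≤-foldr-⊔ {x ∷ _} (there y∈) = ≤-trans (≤-foldr-⊔ y∈) (m≤n⊔m x _)

-- The minimum defining π₂ only unfolds once the vertex set visibly has two elements.
π₂≤p₂ : ∀ {m} (T : Tournament (2 + m)) {u v} → u ≢ v → π₂ T ≤ p₂ T u v
π₂≤p₂ {m} T {u} {v} u≢v = foldr-⊓-≤ (∈-map⁺ (λ uv → p₂ T (proj₁ uv) (proj₂ uv)) uv∈)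
  where
  uv∈ : (u , v) ∈ distinctPairs T
  uv∈ = ∈-concatMap⁺ (λ u → map (u ,_) (filter (λ v → ¬? (u ≟ᶠ v)) (allFin (2 + m))))
    (lose (∈-allFin u) (∈-map⁺ (u ,_) (∈-filter⁺ (λ v → ¬? (u ≟ᶠ v)) (∈-allFin v) u≢v)))

bounds : ∀ {m} (T : Tournament (2 + m)) → 9 ≤ 2 + m →
         6 * irregularity T + (2 + m) + 8 < 12 * π₂ T → Bounds T (π₂ T) (irregularity T)
bounds {m} T 9≤n h = record
  { paths     = λ {u} {v} u≢v → ≤-trans (π₂≤p₂ T u≢v) (≤-trans
      (≤-reflexive (countB-allFin T _))
      (#-mono (λ w → (arc T u w ∧ arc T w v) Bool.≟ true) (out? u ∩? in? v) λ {w} → ∧-true (arc T u w)))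
  ; out-bound = λ u → 2a+1≤ (# (out? u)) (# (in? u)) (out≤ u) (out+in≤ u)
  ; in-bound  = λ u → 2a+1≤ (# (in? u)) (# (out? u)) (in≤ u)
                  (subst (λ k → k + 1 ≤ 2 + m) (+-comm (# (out? u)) (# (in? u))) (out+in≤ u))
  ; gap       = ≤-trans (≤-reflexive (+-suc (6 * irregularity T + (2 + m)) 8)) h
  ; size      = 9≤n
  }
  where
  open Arrows T
  ∧-true : ∀ a {b} → a ∧ b ≡ true → a ≡ true × b ≡ true
  ∧-true true refl = refl , refl
  irregular : ∀ u → ∣ outdeg T u - indeg T u ∣ ≤ irregularity T
  irregular u = ≤-foldr-⊔ (∈-map⁺ (λ u → ∣ outdeg T u - indeg T u ∣) (∈-allFin u))
  out≤ : ∀ u → # (out? u) ≤ # (in? u) + irregularity T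
  out≤ u = subst₂ (λ o d → o ≤ d + irregularity T) (countB-allFin T _) (countB-allFin T _)
    (≤-trans (m≤n+∣m-n∣ (outdeg T u) (indeg T u)) (+-monoʳ-≤ (indeg T u) (irregular u)))
  in≤ : ∀ u → # (in? u) ≤ # (out? u) + irregularity T
  in≤ u = subst₂ (λ d o → d ≤ o + irregularity T) (countB-allFin T _) (countB-allFin T _)
    (≤-trans (m≤n+∣n-m∣ (indeg T u) (outdeg T u)) (+-monoʳ-≤ (outdeg T u) (irregular u)))

theorem8 : (n : ℕ) → 9 ≤ n → (T : Tournament n) →
    n < 12 * π₂ T + 9 →
    6 * irregularity T + n + 8 < 12 * π₂ T →
    PathExtendable T
theorem8 (suc (suc m)) 9≤n T _ h = extend-path T (bounds T 9≤n h)
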